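{- The following decision problem is $\mathsf{PSPACE}$-hard. Input: a punctual reachability game $(V,E,s_0,F)$ on a finite static directed graph with $V=V_1\uplus V_2$, together with a target time $T\in\mathbb{N}$ encoded in binary. Question: does Player 1 win the punctual reachability game with target time $T$ from $s_0$?
   Context: A punctual reachability game $(V,E,s_0,F)$ is played on a (static) finite directed graph with vertices $V=V_1\uplus V_2$, edges $E\subseteq V^2$, initial vertex $s_0\in V$ and target set $F\subseteq V$; vertices in $V_i$ are owned by Player $i$. An additional parameter is a target time $T\in\mathbb{N}$. A token starts in $s_0$ at time $0$; at each step the owner of the current vertex moves the token along an outgoing edge and time advances by one. Player 1 wins a play iff the vertex occupied at time $T$ is in $F$. Convention for dead ends: a player who has to move before time $T$ but has no available successor loses. Player 1 wins the game if she has a strategy (a function from finite histories ending in a vertex of $V_1$ to successors) such that she wins every play consistent with it. -}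

module Defs where

open import Data.Bool.Base using (Bool; true; false; T)
open import Data.Digit using (Bit; 0b; 1b; fromDigits)
open import Data.Fin.Base using (Fin; zero; fromℕ)
open import Data.Fin.Properties using (_≟_)
open import Data.List.Base
  using (List; []; _∷_; _++_; concat; length; map; replicate; reverse; tabulate)
open import Data.Nat.Base using (ℕ; zero; suc; _+_; _*_; _^_; _≤_; _<_)
open import Data.Nat.GeneralisedArithmetic using (iterate)
open import Data.Product.Base using (_×_; _,_; ∃; ∃-syntax; Σ-syntax)
open import Data.Vec.Base as Vec using (Vec)
open import Function.Base using (_∘_)
open import Function.Bundles using (_⇔_)
open import Relation.Binary.PropositionalEquality.Core using (_≡_)
open import Relation.Nullary.Decidable.Core using (does)
open import Relation.Nullary.Negation.Core using (¬_)
open import Relation.Nullary.Reflects using (Reflects)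

Word : Set
Word = List Bit

Language : Set₁
Language = Word → Set

------------------------------------------------------------------------
-- Deterministic multi-tape Turing machines

data Symbol (g : ℕ) : Set where
  blank : Symbol g
  bit   : Bit → Symbol g
  aux   : Fin g → Symbol g

data Move : Set where
  left stay right : Move

data Control (q : ℕ) : Set where
  run  : Fin q → Control q
  halt : Bool → Control q

record Machine (k : ℕ) : Set where
  field
    states : ℕ
    extra  : ℕ
    start  : Fin states
    δ      : Fin states → Vec (Symbol extra) k →
             Control states × Vec (Symbol extra × Move) k

-- A two-way infinite tape: the cells nearest to the head come first in
-- both lists, and all cells not listed are blank.  Cells are never
-- removed, so the listed cells are those of the input together with
-- those visited so far.
record Tape (g : ℕ) : Set where
  constructor tape
  field
    before : List (Symbol g)
    here   : Symbol g
    after  : List (Symbol g)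

  cells : List (Symbol g)
  cells = reverse before ++ here ∷ after

open Tape public

module _ {g : ℕ} where

  fromList : List (Symbol g) → Tape g
  fromList []       = tape [] blank []
  fromList (x ∷ xs) = tape [] x xs

  move : Move → Tape g → Tape g
  move left  (tape []       x rs)       = tape [] blank (x ∷ rs)
  move left  (tape (l ∷ ls) x rs)       = tape ls l (x ∷ rs)
  move stay  t                          = t
  move right (tape ls       x [])       = tape (x ∷ ls) blank []
  move right (tape ls       x (r ∷ rs)) = tape (x ∷ ls) r rs

  act : Symbol g × Move → Tape g → Tape g
  act (y , m) (tape ls _ rs) = move m (tape ls y rs)

  Contains : Tape g → Word → Set
  Contains t w = ∃[ i ] ∃[ j ]
    cells t ≡ replicate i blank ++ map bit w ++ replicate j blank

module Run {k : ℕ} (M : Machine (suc k)) where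
  open Machine M

  record Config : Set where
    constructor config
    field
      control : Control states
      tapes   : Vec (Tape extra) (suc k)

  open Config public

  -- The input is on the first tape, all other tapes are blank.
  initial : Word → Config
  initial w =
    config (run start) (fromList (map bit w) Vec.∷ Vec.replicate k (fromList []))

  step : Config → Config
  step (config (halt b) ts) = config (halt b) ts
  step (config (run q)  ts) =
    let s , as = δ q (Vec.map here ts) in config s (Vec.zipWith act as ts)

  after_steps-on_ : ℕ → Word → Config
  after t steps-on w = iterate step (initial w) t

  space : Config → ℕ
  space c = Vec.sum (Vec.map (length ∘ cells) (tapes c))

  -- The output is what is on the last tape when the machine halts.
  outputTape : Config → Tape extra
  outputTape c = Vec.lookup (tapes c) (fromℕ k)

------------------------------------------------------------------------
-- PSPACE and polynomial-time many-one reductions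

poly : ℕ → ℕ → ℕ → ℕ
poly c d n = c * n ^ d + c

module _ {k : ℕ} (M : Machine (suc k)) where
  open Run M

  Decides : Language → Set
  Decides L = ∀ w → ∃[ t ] ∃[ b ]
    control (after t steps-on w) ≡ halt b × Reflects (L w) b

  SpaceBounded : (ℕ → ℕ) → Set
  SpaceBounded s = ∀ w t → space (after t steps-on w) ≤ s (length w)

  ComputesInTime : (Word → Word) → (ℕ → ℕ) → Set
  ComputesInTime f s = ∀ w → ∃[ t ] t ≤ s (length w) ×
    (∃[ b ] control (after t steps-on w) ≡ halt b) ×
    Contains (outputTape (after t steps-on w)) (f w)

-- Space is measured on single-tape machines, input cells included; as the
-- bounds are arbitrary polynomials, neither choice affects the class.
PSPACE : Language → Set
PSPACE L = Σ[ M ∈ Machine 1 ] Decides M L ×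
  (∃[ c ] ∃[ d ] SpaceBounded M (poly c d))

PolyTime : (Word → Word) → Set
PolyTime f = ∃[ k ] Σ[ M ∈ Machine (suc k) ]
  ∃[ c ] ∃[ d ] ComputesInTime M f (poly c d)

_≤ₚ_ : Language → Language → Set
L ≤ₚ L′ = ∃[ f ] PolyTime f × (∀ w → L w ⇔ L′ (f w))

PSPACE-Hard : Language → Set₁
PSPACE-Hard A = ∀ L → PSPACE L → L ≤ₚ A

------------------------------------------------------------------------
-- Punctual reachability games

data Player : Set where
  player₁ player₂ : Player

record Game : Set where
  field
    size   : ℕ
    owner  : Fin size → Player
    edge   : Fin size → Fin size → Bool
    s₀     : Fin size
    target : Fin size → Bool

module Play (G : Game) where
  open Game G public

  V : Set
  V = Fin size

  Edge : V → V → Set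
  Edge u v = T (edge u v)

  DeadEnd : V → Set
  DeadEnd v = ¬ (∃[ w ] Edge v w)

  -- Histories are indexed by the vertex they end in.
  data History : V → Set where
    []  : History s₀
    _▷_ : ∀ {u v} → History u → Edge u v → History v

  time : ∀ {v} → History v → ℕ
  time []      = 0
  time (h ▷ _) = suc (time h)

  -- The value of `next` is irrelevant at dead ends and at vertices of
  -- Player 2.
  record Strategy : Set where
    field
      next  : ∀ {v} → History v → V
      legal : ∀ {v} (h : History v) → owner v ≡ player₁ → ¬ DeadEnd v →
              Edge v (next h)

  open Strategy public

  data Consistent (σ : Strategy) : ∀ {v} → History v → Set where
    []  : Consistent σ []
    _▷_ : ∀ {u v} {h : History u} → Consistent σ h →
          {e : Edge u v} → (owner u ≡ player₁ → next σ h ≡ v) →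
          Consistent σ (h ▷ e)

  -- A play is over when time τ is reached or, before that, at a dead end,
  -- where the player to move loses.
  Winning : ℕ → Strategy → Set
  Winning τ σ = ∀ {v} (h : History v) → Consistent σ h →
    (time h ≡ τ → T (target v)) ×
    (time h < τ → DeadEnd v → owner v ≡ player₂)

  Player₁Wins : ℕ → Set
  Player₁Wins τ = ∃[ σ ] Winning τ σ

------------------------------------------------------------------------
-- The decision problem

fromBool : Bool → Bit
fromBool false = 0b
fromBool true  = 1b

fromPlayer : Player → Bit
fromPlayer player₁ = 0b
fromPlayer player₂ = 1b

-- The number n of vertices in unary, terminated by 0, followed by n bits
-- each for owners, initial vertex (one-hot) and target set, and by the
-- n × n adjacency matrix, row by row.
encodeGame : Game → Word
encodeGame G =
  replicate size 1b ++ 0b ∷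
  tabulate (λ v → fromPlayer (owner v)) ++
  tabulate (λ v → fromBool (does (v ≟ s₀))) ++
  tabulate (λ v → fromBool (target v)) ++
  concat (tabulate λ u → tabulate λ v → fromBool (edge u v))
  where open Game G

-- The encoding of the game is self-delimiting; the rest of the word is the
-- binary expansion of the target time, least significant bit first, and
-- possibly padded with zeros.
Encodes : Word → Game → ℕ → Set
Encodes w G τ = ∃[ ds ] w ≡ encodeGame G ++ ds × fromDigits ds ≡ τ

PunctualReachability : Language
PunctualReachability w =
  ∃[ G ] ∃[ τ ] Encodes w G τ × Play.Player₁Wins G τ

{-# OPTIONS --safe #-}
{-
A deterministic machine running in polynomial space is a cellular automaton on
a word of polynomial length S: a letter is a tape symbol, possibly with the
control state on top, or a wall at either end.  In the game, a Player 1 vertex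
(cell a, i) claims "cell i holds a after t steps".  Player 1 justifies the claim
by naming the three letters around cell i one step earlier, i.e. by moving to a
Player 2 vertex, and Player 2 answers by doubting one of the three.  After 2t
moves the claim is about the initial word, which is the target set.  As every
cell holds exactly one letter, no negation is needed.  From the initial vertex
Player 1 claims some accepting letter.  By the pigeonhole principle, every
configuration ever reached is reached before time γ ^ S, so it suffices to wait
for 2 ^ (m S) - 1 moves with m = γ + 1; this is an odd number whose binary
expansion consists of ones only.

The machine computing the reduction is obtained from a while program on five
tapes.  Ordering the vertices by kind first and position second makes each row
of the encoding a sequence of passes over the word, printing one bit per cell.
-}
module Submission where

open import Defs
open import Data.Bool.Base using (Bool; true; false; T; if_then_else_)
open import Data.Bool.Properties using (T?)
open import Data.Digit using (Bit; 0b; 1b; fromDigits)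
open import Data.Empty using (⊥-elim)
open import Data.Fin.Base
  using (Fin; zero; suc; toℕ; fromℕ<; combine; remQuot; inject₁; fromℕ; splitAt; _↑ˡ_; _↑ʳ_;
    funToFin; finToFun)
open import Data.Fin.Properties as Fin
  using (any?; all?; remQuot-combine; combine-remQuot; toℕ-fromℕ<; toℕ-inject₁; toℕ<n;
    toℕ-injective; *↔×; +↔⊎; 1↔⊤; 2↔Bool; pigeonhole; finToFun-funToFin; splitAt-↑ˡ; splitAt-↑ʳ)
open import Data.List.Base
  using (List; []; _∷_; _++_; applyUpTo; concat; drop; foldl; length; lookup; map; replicate;
    reverse; tabulate; _ʳ++_)
open import Data.List.Membership.Propositional using (_∈_)
open import Data.List.Membership.Propositional.Properties using (∈-++⁺ʳ; ∈-lookup)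
open import Data.List.Properties
  using (++-assoc; ++-identityʳ; ++-ʳ++; concat-concat; foldl-++; foldl-map; length-++;
    length-applyUpTo; length-map; length-replicate; length-reverse; map-++; map-replicate;
    map-tabulate; map-∘; reverse-involutive; reverse-map; tabulate-cong; ʳ++-defn; ʳ++-ʳ++;
    ∷-injective)
open import Data.List.Relation.Unary.All as All using (All; []; _∷_)
open import Data.List.Relation.Unary.All.Properties using (++⁺)
open import Data.List.Relation.Unary.Any as Any using ()
open import Data.List.Relation.Unary.Any.Properties using (lookup-index)
open import Data.Maybe.Base as Maybe using (Maybe; just; nothing; maybe′; _<∣>_)
open import Data.Nat.Base using (ℕ; zero; suc; _+_; _*_; _^_; _∸_; _≤_; _<_; z≤n; s≤s)
open import Data.Nat.GeneralisedArithmetic using (iterate)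
open import Data.Nat.Induction using (<-rec)
open import Data.Nat.Properties
  using (*-assoc; *-comm; *-distribʳ-+; *-identityʳ; *-identityˡ; *-mono-≤; *-monoʳ-≤; *-monoˡ-≤;
    +-assoc; +-comm; +-identityʳ; +-mono-≤; +-monoʳ-<; +-monoʳ-≤; +-suc; +-∸-assoc; <-irrefl; <⇒≤;
    [m*n]*[o*p]≡[m*o]*[n*p]; ^-*-assoc; ^-distribˡ-+-*; ^-monoʳ-≤; ^-monoˡ-≤; _<?_; m<m+n; m^n>0;
    module ≤-Reasoning; m∸n+n≡m; m∸n≤m; m≤m+n; m≤n+m; m≤n⇒m<n∨m≡n; n<1+n; n∸n≡0; n≤1+n;
    suc-injective; ≤-pred; ≤-refl; ≤-reflexive; ≤-trans; ≮⇒≥)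
open import Data.Product.Base using (_×_; _,_; ∃-syntax; map₁; proj₁; proj₂)
open import Data.Product.Function.NonDependent.Propositional using (_×-↔_)
open import Data.Sum.Base using (_⊎_; inj₁; inj₂; [_,_]′)
open import Data.Sum.Function.Propositional using (_⊎-↔_)
open import Data.Unit.Base using (⊤; tt)
open import Data.Vec.Base as Vec using (Vec; []; _∷_)
open import Function.Base using (_∘_; id)
open import Function.Bundles using (_⇔_; mk⇔; Equivalence; _↔_; Inverse; mk↔ₛ′)
open import Function.Construct.Composition using (_↔-∘_)
open import Function.Construct.Symmetry using (↔-sym)
open import Function.Properties.Equivalence
  using () renaming (trans to ⇔-trans; sym to ⇔-sym; refl to ⇔-refl)
open import Function.Properties.Inverse using (↔⇒↣)
open import Relation.Binary.Definitions using (DecidableEquality)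
open import Relation.Binary.PropositionalEquality
open import Relation.Nullary.Decidable
  using (Dec; yes; no; _×-dec_; _→-dec_; does; dec-true; via-injection)
open import Relation.Nullary.Negation using (¬_; contradiction)
open import Relation.Nullary.Reflects using (ofʸ; ofⁿ)

-- Winning regions and the encoding of games

-- The language asks for some game and time encoded by the word, so aiming at one particular game
-- requires the encoding to determine the winner (`PR⇔Win`). The game tests a single time, whereas
-- the machine may halt at any moment; since a halted configuration never changes again, accepting
-- at some time is the same as accepting at the tested time, once that is late enough. The tape is
-- infinite in both directions, so the initial word has at least as many blanks on each side as the
-- space bound allows cells, and the head never meets a wall. The printing program does not evaluate
-- the space bound: it only squares lengths, and iterated squares of `suc (c + c) + n` dominate
-- `poly c d n`. Edges depend on positions only through being equal, adjacent or far apart; hence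
-- one fixed word, the ruler, shifted by one cell per row, yields every row of the adjacency matrix.
-- Step counts are exact functions of the input length, which separates correctness of the program
-- from the polynomial bound.

module Attractor (G : Game) where
  open Play G

  WinStep : Player → (V → Set) → V → Set
  WinStep player₁ X v = ∃[ w ] Edge v w × X w
  WinStep player₂ X v = ∀ w → Edge v w → X w

  -- The argument is the number of moves left.
  Win : ℕ → V → Set
  Win zero    v = T (target v)
  Win (suc r) v = WinStep (owner v) (Win r) v

  edge? : ∀ u v → Dec (Edge u v)
  edge? u v = T? (edge u v)

  winStep? : ∀ p {X} → (∀ w → Dec (X w)) → ∀ v → Dec (WinStep p X v)
  winStep? player₁ X? v = any? λ w → edge? v w ×-dec X? w
  winStep? player₂ X? v = all? λ w → edge? v w →-dec X? w

  win? : ∀ r v → Dec (Win r v)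
  win? zero    v = T? (target v)
  win? (suc r) v = winStep? (owner v) (win? r) v

  -- `legal` demands a successor at every live vertex of Player 1, also where she is already lost or
  -- the target time has passed.
  fallback : V → V
  fallback v with any? (edge? v)
  ... | yes (w , _) = w
  ... | no  _       = v

  choice : ℕ → V → V
  choice zero    v = fallback v
  choice (suc r) v with winStep? player₁ (win? r) v
  ... | yes (w , _) = w
  ... | no  _       = fallback v

  fallback-legal : ∀ v → ¬ DeadEnd v → Edge v (fallback v)
  fallback-legal v alive with any? (edge? v)
  ... | yes (w , e) = e
  ... | no  dead    = ⊥-elim (alive dead)

  choice-legal : ∀ r v → ¬ DeadEnd v → Edge v (choice r v)
  choice-legal zero    v alive = fallback-legal v alive
  choice-legal (suc r) v alive with winStep? player₁ (win? r) v
  ... | yes (w , e , _) = e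
  ... | no  _           = fallback-legal v alive

  choice-wins : ∀ r v → WinStep player₁ (Win r) v → Win r (choice (suc r) v)
  choice-wins r v win with winStep? player₁ (win? r) v
  ... | yes (w , _ , x) = x
  ... | no  ¬win        = ⊥-elim (¬win win)

  -- The strategy looks only at the vertex and the number of moves left, and keeps the token inside
  -- `Win` of that number; finiteness makes `Win` decidable, so the successor can be computed. A
  -- dead end of Player 1 before time `τ` is excluded because `WinStep player₁` contains an edge.
  Win⇒Player₁Wins : ∀ τ → Win τ s₀ → Player₁Wins τ
  Win⇒Player₁Wins τ win₀ = σ , λ h con → at-end h con , at-dead-end h con
    where
    σ : Strategy
    σ = record
      { next  = λ {v} h → choice (τ ∸ time h) v
      ; legal = λ {v} h _ → choice-legal (τ ∸ time h) v
      }

    remaining : ∀ {t} → t < τ → τ ∸ t ≡ suc (τ ∸ suc t)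
    remaining = +-∸-assoc 1

    invariant : ∀ {v} {h : History v} → Consistent σ h → time h ≤ τ → Win (τ ∸ time h) v
    invariant []                               _   = win₀
    invariant (_▷_ {u} {v} {h} con {e} follow) t<τ
      with invariant con (<⇒≤ t<τ)
    ... | win rewrite remaining t<τ = descend (owner u) refl win
      where
      r = τ ∸ suc (time h)
      descend : ∀ p → owner u ≡ p → WinStep p (Win r) u → Win r v
      descend player₁ o win = subst (Win r) (follow o) (choice-wins r u win)
      descend player₂ o win = win v e

    at-end : ∀ {v} (h : History v) → Consistent σ h → time h ≡ τ → T (target v)
    at-end h con refl with invariant con ≤-refl
    ... | win rewrite n∸n≡0 (time h) = win

    at-dead-end : ∀ {v} (h : History v) → Consistent σ h → time h < τ → DeadEnd v → owner v ≡ player₂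
    at-dead-end {v} h con t<τ dead with invariant con (<⇒≤ t<τ)
    ... | win rewrite remaining t<τ with owner v
    ...   | player₁ = ⊥-elim (dead (proj₁ win , proj₁ (proj₂ win)))
    ...   | player₂ = refl

  -- Induction on the moves left, along histories consistent with the winning strategy. At a vertex
  -- of Player 1 the dead-end clause of `Winning` guarantees a successor, so `legal` applies; at a
  -- vertex of Player 2 every edge extends the history consistently.
  Player₁Wins⇒Win : ∀ τ → Player₁Wins τ → Win τ s₀
  Player₁Wins⇒Win τ (σ , winning) = go τ [] [] refl
    where
    go : ∀ r {v} (h : History v) → Consistent σ h → time h + r ≡ τ → Win r v
    go zero    h con eq = proj₁ (winning h con) (trans (sym (+-identityʳ _)) eq)
    go (suc r) {v} h con eq = step (owner v) refl
      where
      eq′ : suc (time h) + r ≡ τ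
      eq′ = trans (sym (+-suc (time h) r)) eq
      t<τ : time h < τ
      t<τ = subst (time h <_) eq (m<m+n (time h) (s≤s z≤n))
      step : ∀ p → owner v ≡ p → WinStep p (Win r) v
      step player₁ o = next σ h , e , go r (h ▷ e) (con ▷ λ _ → refl) eq′
        where
        alive : ¬ DeadEnd v
        alive dead with trans (sym o) (proj₂ (winning h con) t<τ dead)
        ... | ()
        e : Edge v (next σ h)
        e = legal σ h o alive
      step player₂ o w e = go r (h ▷ e) (con ▷ λ o′ → contradiction (trans (sym o) o′) λ ()) eq′

-- The encoding determines the winner

module _ {n : ℕ} (o₁ o₂ : Fin n → Player) (e₁ e₂ : Fin n → Fin n → Bool) (s₁ s₂ : Fin n) (t₁ t₂ : Fin n → Bool)
  (o≗ : o₁ ≗ o₂) (e≗ : ∀ u → e₁ u ≗ e₂ u) (t≗ : t₁ ≗ t₂) where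

  open Attractor

  private
    G₁ G₂ : Game
    G₁ = record { size = n ; owner = o₁ ; edge = e₁ ; s₀ = s₁ ; target = t₁ }
    G₂ = record { size = n ; owner = o₂ ; edge = e₂ ; s₀ = s₂ ; target = t₂ }

  -- Equal encodings give components that agree pointwise; function extensionality is not at hand to
  -- identify the games, so the winning region is carried over instead.
  Win-cong : ∀ r v → Win G₁ r v → Win G₂ r v
  Win-cong zero    v win = subst T (t≗ v) win
  Win-cong (suc r) v win = step (o₁ v) win (o≗ v)
    where
    step : ∀ p {q} → WinStep G₁ p (Win G₁ r) v → p ≡ q → WinStep G₂ q (Win G₂ r) v
    step player₁ (w , e , x) refl = w , subst T (e≗ v w) e , Win-cong r w x
    step player₂ x           refl = λ w e → Win-cong r w (x w (subst T (sym (e≗ v w)) e))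

tabulate-++-injective : ∀ {a} {A : Set a} {n} (f g : Fin n → A) {xs ys : List A} →
  tabulate f ++ xs ≡ tabulate g ++ ys → f ≗ g × xs ≡ ys
tabulate-++-injective {n = zero}  f g eq = (λ ()) , eq
tabulate-++-injective {n = suc n} f g eq with ∷-injective eq
... | eq₀ , eq′ with tabulate-++-injective (f ∘ suc) (g ∘ suc) eq′
...   | f≗g , rest = (λ { zero → eq₀ ; (suc i) → f≗g i }) , rest

concat-tabulate-++-injective : ∀ {a} {A : Set a} {m n} (f g : Fin m → Fin n → A) {xs ys : List A} →
  concat (tabulate (tabulate ∘ f)) ++ xs ≡ concat (tabulate (tabulate ∘ g)) ++ ys →
  (∀ i → f i ≗ g i) × xs ≡ ys
concat-tabulate-++-injective {m = zero}  f g eq = (λ ()) , eq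
concat-tabulate-++-injective {m = suc m} f g {xs} {ys} eq
  with tabulate-++-injective (f zero) (g zero)
         (trans (sym (++-assoc (tabulate (f zero)) _ xs)) (trans eq (++-assoc (tabulate (g zero)) _ ys)))
... | eq₀ , eq′ with concat-tabulate-++-injective (f ∘ suc) (g ∘ suc) eq′
...   | f≗g , rest = (λ { zero → eq₀ ; (suc i) → f≗g i }) , rest

replicate-1-injective : ∀ m n {xs ys : Word} → replicate m 1b ++ 0b ∷ xs ≡ replicate n 1b ++ 0b ∷ ys → m ≡ n × xs ≡ ys
replicate-1-injective zero    zero    refl = refl , refl
replicate-1-injective zero    (suc n) ()
replicate-1-injective (suc m) zero    ()
replicate-1-injective (suc m) (suc n) eq with replicate-1-injective m n (proj₂ (∷-injective eq))
... | refl , rest = refl , rest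

fromBool-injective : ∀ {b c} → fromBool b ≡ fromBool c → b ≡ c
fromBool-injective {false} {false} eq = refl
fromBool-injective {true}  {true}  eq = refl

fromPlayer-injective : ∀ {p q} → fromPlayer p ≡ fromPlayer q → p ≡ q
fromPlayer-injective {player₁} {player₁} eq = refl
fromPlayer-injective {player₂} {player₂} eq = refl

-- Compare the two one-hot vectors at the entry `s`.
≟-injective : ∀ {n} (s s′ : Fin n) → (∀ v → does (v Fin.≟ s) ≡ does (v Fin.≟ s′)) → s ≡ s′
≟-injective s s′ eq with s Fin.≟ s′ | trans (sym (dec-true (s Fin.≟ s) refl)) (eq s)
... | yes s≡s′ | _  = s≡s′
... | no  _    | ()

encodeGame-++ : ∀ G ds → let open Game G in
  encodeGame G ++ ds ≡
  replicate size 1b ++ 0b ∷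
  tabulate (λ v → fromPlayer (owner v)) ++
  tabulate (λ v → fromBool (does (v Fin.≟ s₀))) ++
  tabulate (λ v → fromBool (target v)) ++
  concat (tabulate λ u → tabulate λ v → fromBool (edge u v)) ++ ds
encodeGame-++ G ds = begin
  (a ++ 0b ∷ b ++ c ++ d ++ e) ++ ds     ≡⟨ ++-assoc a _ ds ⟩
  a ++ 0b ∷ (b ++ c ++ d ++ e) ++ ds     ≡⟨ cong (λ z → a ++ 0b ∷ z) (++-assoc b _ ds) ⟩
  a ++ 0b ∷ b ++ (c ++ d ++ e) ++ ds     ≡⟨ cong (λ z → a ++ 0b ∷ b ++ z) (++-assoc c _ ds) ⟩
  a ++ 0b ∷ b ++ c ++ (d ++ e) ++ ds     ≡⟨ cong (λ z → a ++ 0b ∷ b ++ c ++ z) (++-assoc d _ ds) ⟩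
  a ++ 0b ∷ b ++ c ++ d ++ e ++ ds       ∎
  where
  open ≡-Reasoning
  open Game G
  a = replicate size 1b
  b = tabulate (λ v → fromPlayer (owner v))
  c = tabulate (λ v → fromBool (does (v Fin.≟ s₀)))
  d = tabulate (λ v → fromBool (target v))
  e = concat (tabulate λ u → tabulate λ v → fromBool (edge u v))

-- The unary size comes first and fixes the lengths of all later blocks, so these can be split off
-- one after the other; what remains is the digits.
encode-Win : ∀ G G′ ds ds′ → encodeGame G ++ ds ≡ encodeGame G′ ++ ds′ →
  ds ≡ ds′ × (∀ r → Attractor.Win G r (Game.s₀ G) → Attractor.Win G′ r (Game.s₀ G′))
encode-Win G G′ ds ds′ eq
  with replicate-1-injective _ _ (trans (sym (encodeGame-++ G ds)) (trans eq (encodeGame-++ G′ ds′)))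
... | refl , eq₁ with tabulate-++-injective _ _ eq₁
... | o≗ , eq₂ with tabulate-++-injective _ _ eq₂
... | s≗ , eq₃ with tabulate-++-injective _ _ eq₃
... | t≗ , eq₄ with concat-tabulate-++-injective (λ u v → fromBool (Game.edge G u v))
  (λ u v → fromBool (Game.edge G′ u v)) eq₄
... | e≗ , eq₅ with ≟-injective (Game.s₀ G) (Game.s₀ G′) (fromBool-injective ∘ s≗)
... | refl = eq₅ , λ r → Win-cong _ _ _ _ _ _ _ _ (fromPlayer-injective ∘ o≗)
  (λ u → fromBool-injective ∘ e≗ u) (fromBool-injective ∘ t≗) r _

PR⇔Win : ∀ G ds → PunctualReachability (encodeGame G ++ ds) ⇔ Attractor.Win G (fromDigits ds) (Game.s₀ G)
PR⇔Win G ds = mk⇔ to from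
  where
  to : PunctualReachability (encodeGame G ++ ds) → Attractor.Win G (fromDigits ds) (Game.s₀ G)
  to (G′ , τ , (ds′ , eq , refl) , wins) with encode-Win G′ G ds′ ds (sym eq)
  ... | refl , transfer = transfer τ (Attractor.Player₁Wins⇒Win G′ τ wins)
  from : Attractor.Win G (fromDigits ds) (Game.s₀ G) → PunctualReachability (encodeGame G ++ ds)
  from win = G , fromDigits ds , (ds , refl , refl) , Attractor.Win⇒Player₁Wins G _ win

-- Cellular automata as punctual reachability games

tabulate-+ : ∀ {a} {A : Set a} m {n} (f : Fin (m + n) → A) →
  tabulate f ≡ tabulate (f ∘ (_↑ˡ n)) ++ tabulate (f ∘ (m ↑ʳ_))
tabulate-+ zero    f = refl
tabulate-+ (suc m) f = cong (f zero ∷_) (tabulate-+ m (f ∘ suc))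

tabulate-* : ∀ {a} {A : Set a} m n (f : Fin (m * n) → A) →
  tabulate f ≡ concat (tabulate λ i → tabulate λ j → f (combine {m} {n} i j))
tabulate-* zero    n f = refl
tabulate-* (suc m) n f = trans (tabulate-+ n f)
  (cong (tabulate (f ∘ (_↑ˡ (m * n))) ++_) (tabulate-* m n (f ∘ (n ↑ʳ_))))

tabulate-remQuot : ∀ {a} {A : Set a} m {n} (f : Fin m × Fin n → A) →
  tabulate (f ∘ remQuot {m} n) ≡ concat (tabulate λ i → tabulate λ j → f (i , j))
tabulate-remQuot m {n} f = trans (tabulate-* m n (f ∘ remQuot {m} n))
  (cong concat (tabulate-cong λ i → tabulate-cong λ j → cong f (remQuot-combine {m} {n} i j)))

data Rel : Set where
  far prev cur next : Rel

-- Where the second cell lies as seen from the first.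
rel : ℕ → ℕ → Rel
rel zero          zero          = cur
rel zero          (suc zero)    = next
rel zero          (suc (suc _)) = far
rel (suc i)       (suc j)       = rel i j
rel (suc zero)    zero          = prev
rel (suc (suc _)) zero          = far

rel-cur : ∀ i → rel i i ≡ cur
rel-cur zero    = refl
rel-cur (suc i) = rel-cur i

rel-prev : ∀ i → rel (suc i) i ≡ prev
rel-prev zero    = refl
rel-prev (suc i) = rel-prev i

rel-next : ∀ i → rel i (suc i) ≡ next
rel-next zero    = refl
rel-next (suc i) = rel-next i

rel-inv : ∀ i j → (rel i j ≡ far) ⊎ (rel i j ≡ prev × i ≡ suc j) ⊎ (rel i j ≡ cur × i ≡ j) ⊎
  (rel i j ≡ next × suc i ≡ j)
rel-inv zero          zero          = inj₂ (inj₂ (inj₁ (refl , refl)))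
rel-inv zero          (suc zero)    = inj₂ (inj₂ (inj₂ (refl , refl)))
rel-inv zero          (suc (suc _)) = inj₁ refl
rel-inv (suc zero)    zero          = inj₂ (inj₁ (refl , refl))
rel-inv (suc (suc _)) zero          = inj₁ refl
rel-inv (suc i)       (suc j) with rel-inv i j
... | inj₁ e                      = inj₁ e
... | inj₂ (inj₁ (e , p))         = inj₂ (inj₁ (e , cong suc p))
... | inj₂ (inj₂ (inj₁ (e , p)))  = inj₂ (inj₂ (inj₁ (e , cong suc p)))
... | inj₂ (inj₂ (inj₂ (e , p)))  = inj₂ (inj₂ (inj₂ (e , cong suc p)))

toℕ-subst : ∀ {m n} (p : m ≡ n) (j : Fin m) → toℕ (subst Fin p j) ≡ toℕ j
toℕ-subst refl j = refl

T-does : ∀ {p} {P : Set p} (P? : Dec P) → T (does P?) → P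
T-does (yes p) _ = p

twice : ℕ → ℕ
twice zero    = zero
twice (suc t) = suc (suc (twice t))

record Automaton : Set₁ where
  field
    Γ         : Set
    γ         : ℕ
    finite    : Γ ↔ Fin γ
    wall      : Γ
    rule      : Γ → Γ → Γ → Γ
    rule-wall : ∀ l r → rule l wall r ≡ wall
    accept    : Γ → Bool

  _≟_ : DecidableEquality Γ
  _≟_ = via-injection (↔⇒↣ finite) Fin._≟_

  sweepFrom : Γ → List Γ → List Γ
  sweepFrom l []           = []
  sweepFrom l (m ∷ [])     = rule l m wall ∷ []
  sweepFrom l (m ∷ r ∷ xs) = rule l m r ∷ sweepFrom m (r ∷ xs)

  evolve : List Γ → ℕ → List Γ
  evolve ws zero    = ws
  evolve ws (suc t) = sweepFrom wall (evolve ws t)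

  nth : List Γ → ℕ → Γ
  nth []       _       = wall
  nth (x ∷ xs) zero    = x
  nth (x ∷ xs) (suc j) = nth xs j

  -- Prefixing `l` shifts the word by one, so `nth (l ∷ xs) j` is the left neighbour of cell `j`.
  -- Since `nth` reads `wall` beyond the end and `rule-wall` preserves walls, the local rule holds
  -- at every index, without a bound on `j`.
  nth-sweepFrom : ∀ l xs j → nth (sweepFrom l xs) j ≡ rule (nth (l ∷ xs) j) (nth xs j) (nth xs (suc j))
  nth-sweepFrom l []           j       = sym (rule-wall _ _)
  nth-sweepFrom l (m ∷ [])     zero    = refl
  nth-sweepFrom l (m ∷ [])     (suc j) = sym (rule-wall _ _)
  nth-sweepFrom l (m ∷ r ∷ xs) zero    = refl
  nth-sweepFrom l (m ∷ r ∷ xs) (suc j) = nth-sweepFrom m (r ∷ xs) j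

  length-sweepFrom : ∀ l xs → length (sweepFrom l xs) ≡ length xs
  length-sweepFrom l []           = refl
  length-sweepFrom l (m ∷ [])     = refl
  length-sweepFrom l (m ∷ r ∷ xs) = cong suc (length-sweepFrom m (r ∷ xs))

  length-evolve : ∀ ws t → length (evolve ws t) ≡ length ws
  length-evolve ws zero    = refl
  length-evolve ws (suc t) = trans (length-sweepFrom wall (evolve ws t)) (length-evolve ws t)

  nth-lookup : ∀ xs (j : Fin (length xs)) → nth xs (toℕ j) ≡ lookup xs j
  nth-lookup (x ∷ xs) zero    = refl
  nth-lookup (x ∷ xs) (suc j) = nth-lookup xs j

  Kind : Set
  Kind = ⊤ ⊎ Γ ⊎ (Γ × Γ × Γ)

  pattern start        = inj₁ tt
  pattern cell a       = inj₂ (inj₁ a)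
  pattern triple l m r = inj₂ (inj₂ (l , m , r))

  kinds : ℕ
  kinds = 1 + (γ + γ * (γ * γ))

  kind↔ : Kind ↔ Fin kinds
  kind↔ = ↔-sym +↔⊎ ↔-∘ (↔-sym 1↔⊤ ⊎-↔
    (↔-sym +↔⊎ ↔-∘ (finite ⊎-↔ (↔-sym *↔× ↔-∘ (finite ×-↔ (↔-sym *↔× ↔-∘ (finite ×-↔ finite)))))))

  kindOf : Fin kinds → Kind
  kindOf = Inverse.from kind↔

  ownerOf : Kind → Player
  ownerOf start          = player₁
  ownerOf (cell _)       = player₁
  ownerOf (triple _ _ _) = player₂

  -- A justification stays on its cell and a challenge moves by at most one; the opening claim may
  -- concern any cell. Thus positions enter only through `Rel`, which is what makes the adjacency
  -- matrix printable by passes over a word.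
  kindEdge : Kind → Kind → Rel → Bool
  kindEdge start          (cell a)       _    = accept a
  kindEdge (cell a)       (triple l m r) cur  = does (rule l m r ≟ a)
  kindEdge (triple l _ _) (cell a)       prev = does (a ≟ l)
  kindEdge (triple _ m _) (cell a)       cur  = does (a ≟ m)
  kindEdge (triple _ _ r) (cell a)       next = does (a ≟ r)
  kindEdge _              _              _    = false

  kindTarget : Kind → Γ → Bool
  kindTarget (cell a) x = does (x ≟ a)
  kindTarget _        _ = false

  kindStart : Kind → Rel → Bool
  kindStart start cur = true
  kindStart _     _   = false

  module Board (x : Γ) (xs : List Γ) where

    word : List Γ
    word = x ∷ xs

    S : ℕ
    S = length word

    split : Fin (kinds * S) → Fin kinds × Fin S
    split = remQuot {kinds} S

    kind : Fin (kinds * S) → Kind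
    kind v = kindOf (proj₁ (split v))

    position : Fin (kinds * S) → Fin S
    position v = proj₂ (split v)

    vertex : Kind → Fin S → Fin (kinds * S)
    vertex k i = combine (Inverse.to kind↔ k) i

    kind-vertex : ∀ k i → kind (vertex k i) ≡ k
    kind-vertex k i = trans (cong (kindOf ∘ proj₁) (remQuot-combine (Inverse.to kind↔ k) i))
      (Inverse.strictlyInverseʳ kind↔ k)

    position-vertex : ∀ k i → position (vertex k i) ≡ i
    position-vertex k i = cong proj₂ (remQuot-combine (Inverse.to kind↔ k) i)

    vertex-split : ∀ v → vertex (kind v) (position v) ≡ v
    vertex-split v = trans (cong (λ b → combine b (position v))
      (Inverse.strictlyInverseˡ kind↔ (proj₁ (split v)))) (combine-remQuot {kinds} S v)

    game : Game
    game = record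
      { size   = kinds * S
      ; owner  = λ v → ownerOf (kind v)
      ; edge   = λ u v → kindEdge (kind u) (kind v) (rel (toℕ (position u)) (toℕ (position v)))
      ; s₀     = vertex start zero
      ; target = λ v → kindTarget (kind v) (lookup word (position v))
      }

    open Attractor game

    Wins : ℕ → Kind → Fin S → Set
    Wins r k i = Win r (vertex k i)

    KindStep : Player → (Kind → Fin S → Set) → Kind → Fin S → Set
    KindStep player₁ X k i = ∃[ k′ ] ∃[ i′ ] T (kindEdge k k′ (rel (toℕ i) (toℕ i′))) × X k′ i′
    KindStep player₂ X k i = ∀ k′ i′ → T (kindEdge k k′ (rel (toℕ i) (toℕ i′))) → X k′ i′

    -- The player `p` is kept apart from the owner of the vertex, so that `Wins-suc` can replace the
    -- kind computed from `vertex k i` by `k` in that place alone.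
    WinStep⇔KindStep : ∀ p r k i → WinStep p (Win r) (vertex k i) ⇔ KindStep p (Wins r) k i
    WinStep⇔KindStep p r k i = mk⇔ (to p) (from p)
      where
      edge-vertex : ∀ w → kindEdge (kind (vertex k i)) (kind w) (rel (toℕ (position (vertex k i))) (toℕ (position w)))
                        ≡ kindEdge k (kind w) (rel (toℕ i) (toℕ (position w)))
      edge-vertex w = cong₂ (λ k i → kindEdge k (kind w) (rel (toℕ i) (toℕ (position w)))) (kind-vertex k i)
        (position-vertex k i)
      edge-vertices : ∀ k′ i′ → kindEdge (kind (vertex k i)) (kind (vertex k′ i′))
        (rel (toℕ (position (vertex k i))) (toℕ (position (vertex k′ i′))))
                    ≡ kindEdge k k′ (rel (toℕ i) (toℕ i′))
      edge-vertices k′ i′ = trans (edge-vertex (vertex k′ i′))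
        (cong₂ (λ k′ i′ → kindEdge k k′ (rel (toℕ i) (toℕ i′))) (kind-vertex k′ i′) (position-vertex k′ i′))
      to : ∀ p → WinStep p (Win r) (vertex k i) → KindStep p (Wins r) k i
      to player₁ (w , e , win) = kind w , position w , subst T (edge-vertex w) e ,
        subst (Win r) (sym (vertex-split w)) win
      to player₂ win k′ i′ e = win (vertex k′ i′) (subst T (sym (edge-vertices k′ i′)) e)
      from : ∀ p → KindStep p (Wins r) k i → WinStep p (Win r) (vertex k i)
      from player₁ (k′ , i′ , e , win) = vertex k′ i′ , subst T (sym (edge-vertices k′ i′)) e , win
      from player₂ win w e = subst (Win r) (vertex-split w) (win (kind w) (position w) (subst T (edge-vertex w) e))

    Wins-suc : ∀ r k i → Wins (suc r) k i ⇔ KindStep (ownerOf k) (Wins r) k i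
    Wins-suc r k i = subst (λ k′ → WinStep (ownerOf k′) (Win r) (vertex k i) ⇔ KindStep (ownerOf k) (Wins r) k i)
      (sym (kind-vertex k i)) (WinStep⇔KindStep (ownerOf k) r k i)

    module _ (x≡wall : x ≡ wall) (last≡wall : nth word (length xs) ≡ wall) where

      at : ℕ → ℕ → Γ
      at t = nth (evolve word t)

      at-suc : ∀ t j → at (suc t) j ≡ rule (nth (wall ∷ evolve word t) j) (at t j) (at t (suc j))
      at-suc t j = nth-sweepFrom wall (evolve word t) j

      wall-persists : ∀ j → nth word j ≡ wall → ∀ t → at t j ≡ wall
      wall-persists j eq zero    = eq
      wall-persists j eq (suc t) =
        trans (at-suc t j) (trans (cong (λ m → rule (nth (wall ∷ evolve word t) j) m (at t (suc j)))
          (wall-persists j eq t)) (rule-wall (nth (wall ∷ evolve word t) j) (at t (suc j))))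

      -- A border vertex lacks one of the two outer challenges, but a wall does not
      -- look at its neighbours.
      data Place (i : Fin S) : Set where
        border : nth word (toℕ i) ≡ wall → Place i
        inner  : (l r : Fin S) → toℕ i ≡ suc (toℕ l) → toℕ r ≡ suc (toℕ i) → Place i

      place : ∀ i → Place i
      place zero    = border x≡wall
      place i@(suc j) with m≤n⇒m<n∨m≡n (≤-pred (toℕ<n i))
      ... | inj₂ eq = border (trans (cong (nth word) eq) last≡wall)
      ... | inj₁ i<n = inner (inject₁ j) (fromℕ< (s≤s i<n)) (cong suc (sym (toℕ-inject₁ j))) (toℕ-fromℕ< (s≤s i<n))

      refl-edge : ∀ a → T (does (a ≟ a))
      refl-edge a = subst T (sym (dec-true (a ≟ a) refl)) tt

      does⇒≡ : ∀ {a b} → T (does (a ≟ b)) → a ≡ b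
      does⇒≡ {a} {b} = T-does (a ≟ b)

      -- The induction hypothesis is needed in both directions: surviving the challenges forces the
      -- named letters to be the true ones, and naming the true letters survives every challenge.
      Wins⇔at : ∀ t i a → Wins (twice t) (cell a) i ⇔ at t (toℕ i) ≡ a
      Wins⇔at zero i a = mk⇔
        (λ win → trans (nth-lookup word i) (does⇒≡ (subst T eq win)))
        (λ { refl → subst T (sym eq) (subst (λ y → T (does (lookup word i ≟ y))) (sym (nth-lookup word i))
          (refl-edge _)) })
        where
        eq : kindTarget (kind (vertex (cell a) i)) (lookup word (position (vertex (cell a) i))) ≡
          kindTarget (cell a) (lookup word i)
        eq = cong₂ (λ k i → kindTarget k (lookup word i)) (kind-vertex (cell a) i) (position-vertex (cell a) i)
      Wins⇔at (suc t) i a = mk⇔ to from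
        where
        IH : ∀ i a → Wins (twice t) (cell a) i ⇔ at t (toℕ i) ≡ a
        IH = Wins⇔at t

        to′ : ∀ l m r → KindStep player₂ (Wins (twice t)) (triple l m r) i → at (suc t) (toℕ i) ≡ rule l m r
        to′ l m r win = go (place i)
          where
          m-eq : at t (toℕ i) ≡ m
          m-eq = Equivalence.to (IH i m)
            (win (cell m) i (subst (T ∘ kindEdge (triple l m r) (cell m)) (sym (rel-cur (toℕ i))) (refl-edge m)))
          go : Place i → at (suc t) (toℕ i) ≡ rule l m r
          -- The middle cell can always be doubted, so `m` is the wall; then the named outer
          -- letters, possibly false, do not influence `rule`.
          go (border eq) = trans (wall-persists (toℕ i) eq (suc t))
            (trans (sym (rule-wall l r)) (cong (λ m → rule l m r) (trans (sym (wall-persists (toℕ i) eq t)) m-eq)))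
          go (inner il ir eq-l eq-r) = trans (at-suc t (toℕ i))
            (trans (cong₂ (λ u v → rule u v (at t (suc (toℕ i)))) l-eq m-eq) (cong (rule l m) r-eq))
            where
            l-eq : nth (wall ∷ evolve word t) (toℕ i) ≡ l
            l-eq = trans (cong (nth (wall ∷ evolve word t)) eq-l)
              (Equivalence.to (IH il l) (win (cell l) il
                (subst (T ∘ kindEdge (triple l m r) (cell l))
                  (sym (trans (cong (λ n → rel n (toℕ il)) eq-l) (rel-prev (toℕ il)))) (refl-edge l))))
            r-eq : at t (suc (toℕ i)) ≡ r
            r-eq = trans (cong (at t) (sym eq-r))
              (Equivalence.to (IH ir r) (win (cell r) ir
                (subst (T ∘ kindEdge (triple l m r) (cell r))
                  (sym (trans (cong (rel (toℕ i)) eq-r) (rel-next (toℕ i)))) (refl-edge r))))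

        to : Wins (twice (suc t)) (cell a) i → at (suc t) (toℕ i) ≡ a
        to win with Equivalence.to (Wins-suc (suc (twice t)) (cell a) i) win
        ... | start , i′ , e , _ = ⊥-elim e
        ... | cell _ , i′ , e , _ = ⊥-elim e
        ... | triple l m r , i′ , e , win′ with rel (toℕ i) (toℕ i′) | rel-inv (toℕ i) (toℕ i′)
        ...   | far  | _ = ⊥-elim e
        ...   | prev | _ = ⊥-elim e
        ...   | next | _ = ⊥-elim e
        ...   | cur  | inj₂ (inj₂ (inj₁ (_ , i≡i′))) with toℕ-injective i≡i′
        ...     | refl = trans (to′ l m r (Equivalence.to (Wins-suc (twice t) (triple l m r) i) win′)) (does⇒≡ e)

        from : at (suc t) (toℕ i) ≡ a → Wins (twice (suc t)) (cell a) i
        from refl = Equivalence.from (Wins-suc (suc (twice t)) (cell a) i)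
          ( triple l m r , i
          , subst (T ∘ kindEdge (cell a) (triple l m r)) (sym (rel-cur (toℕ i)))
            (subst (λ y → T (does (y ≟ a))) (at-suc t (toℕ i)) (refl-edge a))
          , Equivalence.from (Wins-suc (twice t) (triple l m r) i) all)
          where
          l = nth (wall ∷ evolve word t) (toℕ i)
          m = at t (toℕ i)
          r = at t (suc (toℕ i))
          all : KindStep player₂ (Wins (twice t)) (triple l m r) i
          all start          i′ e = ⊥-elim e
          all (triple _ _ _) i′ e = ⊥-elim e
          all (cell b)       i′ e with rel (toℕ i) (toℕ i′) | rel-inv (toℕ i) (toℕ i′)
          ... | far  | _ = ⊥-elim e
          -- Here the position `i` is the successor of `i′`, and the wall put in front of the word
          -- turns the left neighbour of cell `i` into cell `i′`.
          ... | prev | inj₂ (inj₁ (_ , eq))        =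
            Equivalence.from (IH i′ b) (sym (trans (does⇒≡ e) (cong (nth (wall ∷ evolve word t)) eq)))
          ... | prev | inj₂ (inj₂ (inj₁ (() , _)))
          ... | prev | inj₂ (inj₂ (inj₂ (() , _)))
          ... | cur  | inj₂ (inj₂ (inj₁ (_ , eq))) =
            Equivalence.from (IH i′ b) (sym (trans (does⇒≡ e) (cong (at t) eq)))
          ... | next | inj₂ (inj₂ (inj₂ (_ , eq))) =
            Equivalence.from (IH i′ b) (sym (trans (does⇒≡ e) (cong (at t) eq)))

      Wins⇔accept : ∀ t → Win (suc (twice t)) (vertex start zero) ⇔ (∃[ i ] T (accept (lookup (evolve word t) i)))
      Wins⇔accept t = mk⇔ to from
        where
        len : length (evolve word t) ≡ S
        len = length-evolve word t
        to : Win (suc (twice t)) (vertex start zero) → ∃[ i ] T (accept (lookup (evolve word t) i))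
        to win with Equivalence.to (Wins-suc (twice t) start zero) win
        ... | start , _ , e , _ = ⊥-elim e
        ... | triple _ _ _ , _ , e , _ = ⊥-elim e
        ... | cell a , i , e , win′ = i′ , subst (T ∘ accept) (sym eq) e
          where
          i′ : Fin (length (evolve word t))
          i′ = subst Fin (sym len) i
          eq : lookup (evolve word t) i′ ≡ a
          eq = trans (sym (nth-lookup (evolve word t) i′))
            (trans (cong (at t) (toℕ-subst (sym len) i)) (Equivalence.to (Wins⇔at t i a) win′))
        from : ∃[ i ] T (accept (lookup (evolve word t) i)) → Win (suc (twice t)) (vertex start zero)
        from (i , acc) = Equivalence.from (Wins-suc (twice t) start zero)
          (cell a , i′ , acc , Equivalence.from (Wins⇔at t i′ a)
            (trans (cong (at t) (toℕ-subst len i)) (nth-lookup (evolve word t) i)))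
          where
          a = lookup (evolve word t) i
          i′ : Fin S
          i′ = subst Fin len i

-- Turing machines as cellular automata

iterate-suc : ∀ {a} {A : Set a} (f : A → A) x n → iterate f x (suc n) ≡ f (iterate f x n)
iterate-suc f x zero    = refl
iterate-suc f x (suc n) = iterate-suc f (f x) n

module _ (A : Automaton) where
  open Automaton A

  nth-injective : ∀ xs ys → length xs ≡ length ys → (∀ j → j < length xs → nth xs j ≡ nth ys j) → xs ≡ ys
  nth-injective []       []       _   _  = refl
  nth-injective (x ∷ xs) (y ∷ ys) len eq =
    cong₂ _∷_ (eq zero (s≤s z≤n)) (nth-injective xs ys (suc-injective len) (λ j j< → eq (suc j) (s≤s j<)))

  evolve-+ : ∀ ws {t u} k → evolve ws t ≡ evolve ws u → evolve ws (k + t) ≡ evolve ws (k + u)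
  evolve-+ ws zero    eq = eq
  evolve-+ ws (suc k) eq = cong (sweepFrom wall) (evolve-+ ws k eq)

  -- Among the times 0 to `N` two, `i` and the later `j`, carry the same word, because a word is
  -- coded by a number below `N`. If `t` is at least `N`, then by determinism `t` can be lowered by
  -- the difference of `j` and `i` without changing the word, and well-founded induction applies.
  evolve-recurs : ∀ ws t → ∃[ k ] k < γ ^ length ws × evolve ws t ≡ evolve ws k
  evolve-recurs ws = <-rec _ go
    where
    N = γ ^ length ws

    code : ℕ → Fin N
    code t = funToFin {length ws} {γ} (λ j → Inverse.to finite (nth (evolve ws t) (toℕ j)))

    code-injective : ∀ t u → code t ≡ code u → evolve ws t ≡ evolve ws u
    code-injective t u eq = nth-injective _ _ (trans (length-evolve ws t) (sym (length-evolve ws u))) λ j j< →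
      let j<S = subst (j <_) (length-evolve ws t) j<
          i   = fromℕ< j<S
          nth-code : ∀ t → Inverse.from finite (finToFun {γ} {length ws} (code t) i) ≡ nth (evolve ws t) j
          nth-code t = trans (cong (Inverse.from finite) (finToFun-funToFin {length ws} {γ} _ i))
            (trans (Inverse.strictlyInverseʳ finite _) (cong (nth (evolve ws t)) (Fin.toℕ-fromℕ< j<S)))
      in trans (sym (nth-code t)) (trans (cong (λ c → Inverse.from finite (finToFun {γ} {length ws} c i)) eq)
        (nth-code u))

    go : ∀ t → (∀ {u} → u < t → ∃[ k ] k < N × evolve ws u ≡ evolve ws k) → ∃[ k ] k < N × evolve ws t ≡ evolve ws k
    go t rec with t <? N
    ... | yes t<N = t , t<N , refl
    ... | no  t≮N with pigeonhole (n<1+n N) (code ∘ toℕ)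
    ...   | i , j , i<j , eq with rec (subst (u <_) t≡ (+-monoʳ-< k i<j))
      where
      k = t ∸ toℕ j
      u = k + toℕ i
      t≡ : k + toℕ j ≡ t
      t≡ = m∸n+n≡m (≤-trans (≤-pred (toℕ<n j)) (≮⇒≥ t≮N))
    ...     | k′ , k′<N , eq′ = k′ , k′<N , trans (sym (cong (evolve ws) t≡))
                (trans (evolve-+ ws k (sym (code-injective (toℕ i) (toℕ j) eq))) eq′)
      where
      k = t ∸ toℕ j
      t≡ : k + toℕ j ≡ t
      t≡ = m∸n+n≡m (≤-trans (≤-pred (toℕ<n j)) (≮⇒≥ t≮N))

module Simulation (M : Machine 1) where
  open Machine M
  open Run M

  Sym : Set
  Sym = Symbol extra

  Ctl : Set
  Ctl = Control states

  Letter : Set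
  Letter = ⊤ ⊎ Sym ⊎ (Ctl × Sym)

  pattern wallₗ    = inj₁ tt
  pattern plain x  = inj₂ (inj₁ x)
  pattern head c x = inj₂ (inj₂ (c , x))

  symbol↔ : Sym ↔ Fin (1 + (2 + extra))
  symbol↔ = ↔-sym +↔⊎ ↔-∘ ((↔-sym 1↔⊤ ⊎-↔ ↔-sym +↔⊎) ↔-∘ mk↔ₛ′ to from
    (λ { (inj₁ tt) → refl ; (inj₂ (inj₁ _)) → refl ; (inj₂ (inj₂ _)) → refl })
    (λ { blank → refl ; (bit _) → refl ; (aux _) → refl }))
    where
    to : Sym → ⊤ ⊎ Bit ⊎ Fin extra
    to blank   = inj₁ tt
    to (bit b) = inj₂ (inj₁ b)
    to (aux i) = inj₂ (inj₂ i)
    from : ⊤ ⊎ Bit ⊎ Fin extra → Sym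
    from (inj₁ tt)       = blank
    from (inj₂ (inj₁ b)) = bit b
    from (inj₂ (inj₂ i)) = aux i

  control↔ : Ctl ↔ Fin (states + 2)
  control↔ = ↔-sym +↔⊎ ↔-∘ ((mk↔ₛ′ id id (λ _ → refl) (λ _ → refl) ⊎-↔ ↔-sym 2↔Bool) ↔-∘ mk↔ₛ′ to from
    (λ { (inj₁ _) → refl ; (inj₂ _) → refl })
    (λ { (run _) → refl ; (halt _) → refl }))
    where
    to : Ctl → Fin states ⊎ Bool
    to (run q)  = inj₁ q
    to (halt b) = inj₂ b
    from : Fin states ⊎ Bool → Ctl
    from (inj₁ q) = run q
    from (inj₂ b) = halt b

  letter↔ : Letter ↔ Fin (1 + ((1 + (2 + extra)) + (states + 2) * (1 + (2 + extra))))
  letter↔ = ↔-sym +↔⊎ ↔-∘ (↔-sym 1↔⊤ ⊎-↔ (↔-sym +↔⊎ ↔-∘ (symbol↔ ⊎-↔ (↔-sym *↔× ↔-∘ (control↔ ×-↔ symbol↔)))))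

  -- A halted head is given an idle step, so the automaton, which cannot stop, keeps displaying the
  -- verdict.
  outcome : Ctl → Sym → Ctl × (Sym × Move)
  outcome (halt b) x = halt b , (x , stay)
  outcome (run q)  x = proj₁ (δ q (x ∷ [])) , Vec.head (proj₂ (δ q (x ∷ [])))

  departs : Move → Ctl × (Sym × Move) → Maybe Ctl
  departs left  (c , _ , left)  = just c
  departs stay  (c , _ , stay)  = just c
  departs right (c , _ , right) = just c
  departs _     _               = nothing

  sends : Move → Letter → Maybe Ctl
  sends m (head c x) = departs m (outcome c x)
  sends m _          = nothing

  place : Sym → Maybe Ctl → Letter
  place x nothing  = plain x
  place x (just c) = head c x

  -- The words that arise contain one head, so at most one alternative of `<∣>` is present and their
  -- order is immaterial there.
  ruleₗ : Letter → Letter → Letter → Letter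
  ruleₗ l wallₗ      r = wallₗ
  ruleₗ l (plain x)  r = place x (sends right l <∣> sends left r)
  ruleₗ l (head c x) r = place (proj₁ (proj₂ (outcome c x)))
    (sends stay (head c x) <∣> (sends right l <∣> sends left r))

  acceptₗ : Letter → Bool
  acceptₗ (head (halt b) _) = b
  acceptₗ _                 = false

  automaton : Automaton
  automaton = record
    { Γ         = Letter
    ; γ         = 1 + ((1 + (2 + extra)) + (states + 2) * (1 + (2 + extra)))
    ; finite    = letter↔
    ; wall      = wallₗ
    ; rule      = ruleₗ
    ; rule-wall = λ _ _ → refl
    ; accept    = acceptₗ
    }

  open Automaton automaton using (sweepFrom; evolve; nth)

  -- One sweep is one machine step

  data Quiet : Letter → Set where
    wall-quiet  : Quiet wallₗ
    plain-quiet : ∀ {x} → Quiet (plain x)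

  rule-quiet : ∀ {l m r} → Quiet l → Quiet m → Quiet r → ruleₗ l m r ≡ m
  rule-quiet wall-quiet  wall-quiet  _           = refl
  rule-quiet plain-quiet wall-quiet  _           = refl
  rule-quiet wall-quiet  plain-quiet wall-quiet  = refl
  rule-quiet wall-quiet  plain-quiet plain-quiet = refl
  rule-quiet plain-quiet plain-quiet wall-quiet  = refl
  rule-quiet plain-quiet plain-quiet plain-quiet = refl

  sends-quiet : ∀ {l} m → Quiet l → sends m l ≡ nothing
  sends-quiet m wall-quiet  = refl
  sends-quiet m plain-quiet = refl

  <∣>-nothing : ∀ (s : Maybe Ctl) → (s <∣> nothing) ≡ s
  <∣>-nothing nothing  = refl
  <∣>-nothing (just _) = refl

  sweep-quiet : ∀ {l ms} → Quiet l → All Quiet ms → sweepFrom l ms ≡ ms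
  sweep-quiet ql []             = refl
  sweep-quiet ql (qm ∷ [])      = cong (_∷ []) (rule-quiet ql qm wall-quiet)
  sweep-quiet ql (qm ∷ qr ∷ qs) = cong₂ _∷_ (rule-quiet ql qm qr) (sweep-quiet qm (qr ∷ qs))

  -- A head sent onto a wall would be swallowed; `layout-step` avoids this by assuming a blank of
  -- padding on either side.
  receive : Maybe Ctl → Letter → Letter
  receive s (plain x) = place x s
  receive s l         = l

  onHead : (Letter → Letter) → List Letter → List Letter
  onHead f []       = []
  onHead f (l ∷ ls) = f l ∷ ls

  rule-receiveˡ : ∀ {l m} h → Quiet l → Quiet m → ruleₗ l m h ≡ receive (sends left h) m
  rule-receiveˡ h ql wall-quiet  = refl
  rule-receiveˡ h ql plain-quiet rewrite sends-quiet right ql = refl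

  rule-receiveʳ : ∀ {m r} h → Quiet m → Quiet r → ruleₗ h m r ≡ receive (sends right h) m
  rule-receiveʳ h wall-quiet  qr = refl
  rule-receiveʳ h plain-quiet qr rewrite sends-quiet left qr | <∣>-nothing (sends right h) = refl

  stays : Ctl → Sym → Letter
  stays c x = place (proj₁ (proj₂ (outcome c x))) (departs stay (outcome c x))

  rule-stays : ∀ {l r} c x → Quiet l → Quiet r → ruleₗ l (head c x) r ≡ stays c x
  rule-stays c x ql qr
    rewrite sends-quiet right ql | sends-quiet left qr | <∣>-nothing (departs stay (outcome c x)) = refl

  sweep-right : ∀ h {R} → All Quiet R → sweepFrom h R ≡ onHead (receive (sends right h)) R
  sweep-right h []             = refl
  sweep-right h (qr ∷ [])      = cong (_∷ []) (rule-receiveʳ h qr wall-quiet)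
  sweep-right h (qr ∷ qb ∷ qB) = cong₂ _∷_ (rule-receiveʳ h qr qb) (sweep-quiet qr (qb ∷ qB))

  -- Information travels one cell per sweep, so only the head and its two neighbours can change. The
  -- letter `p` before the prefix varies in the induction, as each sweep passes on the previous
  -- letter.
  sweep-local : ∀ {p A l c x r B} → Quiet p → All Quiet A → Quiet l → All Quiet (r ∷ B) →
    sweepFrom p (A ++ l ∷ head c x ∷ r ∷ B) ≡
    A ++ receive (sends left (head c x)) l ∷ stays c x ∷ onHead (receive (sends right (head c x))) (r ∷ B)
  sweep-local {c = c} {x} qp [] ql qB@(qr ∷ _) =
    cong₂ _∷_ (rule-receiveˡ (head c x) qp ql) (cong₂ _∷_ (rule-stays c x ql qr) (sweep-right (head c x) qB))
  sweep-local qp (qa ∷ [])      ql qB = cong₂ _∷_ (rule-quiet qp qa ql) (sweep-local qa [] ql qB)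
  sweep-local qp (qa ∷ qb ∷ qA) ql qB = cong₂ _∷_ (rule-quiet qp qa qb) (sweep-local qa (qb ∷ qA) ql qB)

  All-ʳ++ : ∀ {L R} → All Quiet L → All Quiet R → All Quiet (L ʳ++ R)
  All-ʳ++ []       qR = qR
  All-ʳ++ (q ∷ qL) qR = All-ʳ++ qL (q ∷ qR)

  sweep-zipper : ∀ {l L c x r R} → All Quiet (l ∷ L) → All Quiet (r ∷ R) →
    sweepFrom wallₗ ((l ∷ L) ʳ++ (head c x ∷ r ∷ R)) ≡
    onHead (receive (departs left (outcome c x))) (l ∷ L) ʳ++
    (stays c x ∷ onHead (receive (departs right (outcome c x))) (r ∷ R))
  sweep-zipper {l} {L} {c} {x} {r} {R} (ql ∷ qL) qR = begin
    sweepFrom wallₗ (L ʳ++ (l ∷ head c x ∷ r ∷ R))       ≡⟨ cong (sweepFrom wallₗ) (ʳ++-defn L) ⟩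
    sweepFrom wallₗ (reverse L ++ l ∷ head c x ∷ r ∷ R)  ≡⟨ sweep-local wall-quiet (All-ʳ++ qL []) ql qR ⟩
    reverse L ++ new                                      ≡⟨ ʳ++-defn L ⟨
    L ʳ++ new                                             ∎
    where
    open ≡-Reasoning
    new = receive (sends left (head c x)) l ∷ stays c x ∷ onHead (receive (sends right (head c x))) (r ∷ R)

  padded : List Sym → ℕ → List Letter
  padded xs i = map plain xs ++ replicate i (plain blank) ++ wallₗ ∷ []

  padded-quiet : ∀ xs i → All Quiet (padded xs i)
  padded-quiet []       zero    = wall-quiet ∷ []
  padded-quiet []       (suc i) = plain-quiet ∷ padded-quiet [] i
  padded-quiet (x ∷ xs) i       = plain-quiet ∷ padded-quiet xs i

  receive-nothing : ∀ xs i → onHead (receive nothing) (padded xs i) ≡ padded xs i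
  receive-nothing []       zero    = refl
  receive-nothing []       (suc i) = refl
  receive-nothing (x ∷ xs) i       = refl

  layout : Ctl → Tape extra → ℕ → ℕ → List Letter
  layout c (tape ls x rs) i j = padded ls i ʳ++ (head c x ∷ padded rs j)

  sweep-layout : ∀ c ls x rs i j →
    sweepFrom wallₗ (layout c (tape ls x rs) i j) ≡
    onHead (receive (departs left (outcome c x))) (padded ls i) ʳ++
    (stays c x ∷ onHead (receive (departs right (outcome c x))) (padded rs j))
  sweep-layout c ls x rs i j
    with padded ls i | padded-quiet ls i | nonempty ls i | padded rs j | padded-quiet rs j | nonempty rs j
    where
    nonempty : ∀ xs i → ∃[ l ] ∃[ L ] padded xs i ≡ l ∷ L
    nonempty []       zero    = _ , _ , refl
    nonempty []       (suc i) = _ , _ , refl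
    nonempty (x ∷ xs) i       = _ , _ , refl
  ... | _ | qL | _ , _ , refl | _ | qR | _ , _ , refl = sweep-zipper qL qR

  width : Tape extra → ℕ
  width (tape ls x rs) = length ls + suc (length rs)

  width-cells : ∀ t → length (cells t) ≡ width t
  width-cells (tape ls x rs) = trans (length-++ (reverse ls)) (cong (_+ suc (length rs)) (length-reverse ls))

  -- Padding and listed cells together never get fewer; as the tape fits into the
  -- initial padding, neither side runs out of it.
  Grows : Tape extra → Tape extra → ℕ → ℕ → Set
  Grows t t′ i i′ = i + width t ≤ i′ + width t′

  layout-step : ∀ c t i j → let c′ , a = outcome c (Tape.here t) in
    ∃[ i′ ] ∃[ j′ ] sweepFrom wallₗ (layout c t (suc i) (suc j)) ≡ layout c′ (act a t) i′ j′
      × Grows t (act a t) (suc i) i′ × Grows t (act a t) (suc j) j′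
  layout-step c (tape ls x rs) i j with outcome c x | sweep-layout c ls x rs (suc i) (suc j)
  ... | s , y , stay | eq = suc i , suc j ,
    trans eq (cong₂ (λ L R → L ʳ++ (head s y ∷ R)) (receive-nothing ls (suc i)) (receive-nothing rs (suc j))) ,
    ≤-refl , ≤-refl
  -- In this case and its mirror image the head enters an unlisted cell: one blank of padding is
  -- used up, and the width of the tape grows by one in exchange.
  layout-step c (tape [] x rs) i j | s , y , left | eq = i , suc j ,
    trans eq (cong (λ R → padded [] i ʳ++ (head s blank ∷ plain y ∷ R)) (receive-nothing rs (suc j))) ,
    ≤-reflexive (sym (+-suc i _)) , +-monoʳ-≤ (suc j) (n≤1+n _)
  layout-step c (tape (l ∷ ls) x rs) i j | s , y , left | eq = suc i , suc j ,
    trans eq (cong (λ R → padded ls (suc i) ʳ++ (head s l ∷ plain y ∷ R)) (receive-nothing rs (suc j))) ,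
    ≤-reflexive (cong (suc i +_) (sym (+-suc (length ls) _))) ,
      ≤-reflexive (cong (suc j +_) (sym (+-suc (length ls) _)))
  layout-step c (tape ls x []) i j | s , y , right | eq = suc i , j ,
    trans eq (cong (λ L → (plain y ∷ L) ʳ++ (head s blank ∷ padded [] j)) (receive-nothing ls (suc i))) ,
    +-monoʳ-≤ (suc i) (n≤1+n _) , ≤-reflexive (sym (+-suc j _))
  layout-step c (tape ls x (r ∷ rs)) i j | s , y , right | eq = suc i , suc j ,
    trans eq (cong (λ L → (plain y ∷ L) ʳ++ (head s r ∷ padded rs (suc j))) (receive-nothing ls (suc i))) ,
    ≤-reflexive (cong (suc i +_) (+-suc (length ls) _)) , ≤-reflexive (cong (suc j +_) (+-suc (length ls) _))

  single : Config → Tape extra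
  single = Vec.head ∘ tapes

  outcome-step : ∀ c t → step (config c (t ∷ [])) ≡
    (let c′ , a = outcome c (Tape.here t) in config c′ (act a t ∷ []))
  outcome-step (halt b) t = refl
  outcome-step (run q)  t with δ q (Tape.here t ∷ [])
  ... | s , a ∷ [] = refl

  layout-accepts : ∀ c t i j → (∃[ p ] T (acceptₗ (lookup (layout c t i j) p))) ⇔ c ≡ halt true
  layout-accepts c t@(tape ls x rs) i j = mk⇔ to from
    where
    Accepts : Letter → Set
    Accepts l = T (acceptₗ l) → c ≡ halt true
    quiet : ∀ {l} → Quiet l → Accepts l
    quiet wall-quiet  ()
    quiet plain-quiet ()
    halted : ∀ c → T (acceptₗ (head c x)) → c ≡ halt true
    halted (halt true) _ = refl
    split : layout c t i j ≡ reverse (padded ls i) ++ head c x ∷ padded rs j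
    split = ʳ++-defn (padded ls i)
    all : All Accepts (layout c t i j)
    all = subst (All Accepts) (sym split)
      (++⁺ (All.map quiet (All-ʳ++ (padded-quiet ls i) [])) (halted c ∷ All.map quiet (padded-quiet rs j)))
    to : (∃[ p ] T (acceptₗ (lookup (layout c t i j) p))) → c ≡ halt true
    to (p , acc) = All.lookup all (∈-lookup p) acc
    from : c ≡ halt true → ∃[ p ] T (acceptₗ (lookup (layout c t i j) p))
    from refl = Any.index h∈ , subst (T ∘ acceptₗ) (lookup-index h∈) tt
      where
      h∈ : head c x ∈ layout c t i j
      h∈ = subst (head c x ∈_) (sym split) (∈-++⁺ʳ (reverse (padded ls i)) (Any.here refl))

  module _ (w : Word) (pad : ℕ) (bound : ∀ t → space (after t steps-on w) ≤ pad) where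

    first : List Letter
    first = layout (run start) (fromList (map bit w)) pad pad

    narrow : ∀ t → length (cells t) + 0 ≤ pad → width t ≤ pad
    narrow t = subst (_≤ pad) (trans (+-identityʳ (length (cells t))) (width-cells t))

    -- The strict inequality holds at first because the width is at least one. Against the space
    -- bound it forces `i` and `j` to be positive before every step, as `layout-step` requires.
    trace : ∀ t → ∃[ i ] ∃[ j ]
      (evolve first t ≡ layout (control (after t steps-on w)) (single (after t steps-on w)) i j)
      × pad < i + width (single (after t steps-on w)) × pad < j + width (single (after t steps-on w))
    trace zero = pad , pad , refl , pad< , pad<
      where
      pad< : pad < pad + width (fromList (map bit w))
      pad< = m<m+n pad (subst (0 <_) (sym (+-suc (length (before (fromList (map bit w)))) _)) (s≤s z≤n))
    trace (suc t) rewrite iterate-suc step (initial w) t with after t steps-on w | trace t | bound t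
    ... | config c (T ∷ []) | zero , j , _ , i-wide , _ | fits =
      contradiction (≤-trans i-wide (narrow T fits)) (<-irrefl refl)
    ... | config c (T ∷ []) | suc i , zero , _ , _ , j-wide | fits =
      contradiction (≤-trans j-wide (narrow T fits)) (<-irrefl refl)
    ... | config c (T ∷ []) | suc i , suc j , eq , i-wide , j-wide | fits
      rewrite outcome-step c T with layout-step c T i j
    ... | i′ , j′ , eq′ , grows-i , grows-j =
      i′ , j′ , trans (cong (sweepFrom wallₗ) eq) eq′ , ≤-trans i-wide grows-i , ≤-trans j-wide grows-j

    evolve-accepts : ∀ t → (∃[ p ] T (acceptₗ (lookup (evolve first t) p))) ⇔ control (after t steps-on w) ≡ halt true
    evolve-accepts t with trace t
    ... | i , j , eq , _ rewrite eq = layout-accepts (control (after t steps-on w)) (single (after t steps-on w)) i j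

    halt-stable : ∀ {t b} k → control (after t steps-on w) ≡ halt b → control (after (k + t) steps-on w) ≡ halt b
    halt-stable         zero    eq = eq
    halt-stable {t} {b} (suc k) eq rewrite iterate-suc step (initial w) (k + t)
      with after (k + t) steps-on w | halt-stable {t} k eq
    ... | config _ _ | refl = refl

    -- The word of an accepting time already occurs at some time `k` below the number of words,
    -- hence not after `h`; as halting is permanent, the machine is still accepting at `h`.
    accepts-in-time : ∀ h → Automaton.γ automaton ^ length first ≤ suc h →
      (∃[ t ] control (after t steps-on w) ≡ halt true) ⇔ (∃[ p ] T (acceptₗ (lookup (evolve first h) p)))
    accepts-in-time h enough = mk⇔ to (λ acc → h , Equivalence.to (evolve-accepts h) acc)
      where
      to : (∃[ t ] control (after t steps-on w) ≡ halt true) → ∃[ p ] T (acceptₗ (lookup (evolve first h) p))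
      to (t , eq) with evolve-recurs automaton first t
      ... | k , k<N , same = Equivalence.from (evolve-accepts h)
        (subst (λ n → control (after n steps-on w) ≡ halt true) (m∸n+n≡m (≤-pred (≤-trans k<N enough)))
          (halt-stable {k} (h ∸ k) (Equivalence.to (evolve-accepts k)
            (subst (λ ws → ∃[ p ] T (acceptₗ (lookup ws p))) same (Equivalence.from (evolve-accepts t) eq)))))

-- While programs on multi-tape machines

module Programs (k g : ℕ) where

  Tapes : Set
  Tapes = Vec (Tape g) (suc k)

  Scan : Set
  Scan = Vec (Symbol g) (suc k)

  Actions : Set
  Actions = Vec (Symbol g × Move) (suc k)

  scan : Tapes → Scan
  scan = Vec.map here

  infixr 5 _⨟_

  data Program : Set where
    once  : (Scan → Actions) → Program
    _⨟_   : Program → Program → Program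
    while : (Scan → Bool) → Program → Program

  -- The index is the exact number of machine steps. A loop test is a step of its own, which
  -- rewrites the scanned symbols and does not move.
  data Exec : Program → Tapes → ℕ → Tapes → Set where
    once : ∀ {f ts ts′} → Vec.zipWith act (f (scan ts)) ts ≡ ts′ → Exec (once f) ts 1 ts′
    _⨟_  : ∀ {P Q ts ts′ ts″ m n} → Exec P ts m ts′ → Exec Q ts′ n ts″ → Exec (P ⨟ Q) ts (m + n) ts″
    stop : ∀ {b P ts} → b (scan ts) ≡ false → Exec (while b P) ts 1 ts
    loop : ∀ {b P ts ts′ ts″ m n} → b (scan ts) ≡ true → Exec P ts m ts′ → Exec (while b P) ts′ n ts″ →
           Exec (while b P) ts (suc (m + n)) ts″

  size : Program → ℕ
  size (once f)    = 1
  size (P ⨟ Q)     = size P + size Q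
  size (while b P) = suc (size P)

  entry : ∀ P → Fin (size P)
  entry (once f)    = zero
  entry (P ⨟ Q)     = entry P ↑ˡ size Q
  entry (while b P) = zero

  idle : ∀ {n} → Vec (Symbol g) n → Vec (Symbol g × Move) n
  idle = Vec.map (_, stay)

  -- `nothing` means that control leaves the program.
  control-flow : ∀ P → Fin (size P) → Scan → Maybe (Fin (size P)) × Actions
  control-flow (once f)    _       s = nothing , f s
  control-flow (P ⨟ Q)     p       s =
    [ (λ p → map₁ (just ∘ maybe′ (_↑ˡ size Q) (size P ↑ʳ entry Q)) (control-flow P p s))
    , (λ q → map₁ (Maybe.map (size P ↑ʳ_)) (control-flow Q q s))
    ]′ (splitAt (size P) p)
  control-flow (while b P) zero    s = (if b s then just (suc (entry P)) else nothing) , idle s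
  control-flow (while b P) (suc p) s = map₁ (just ∘ maybe′ suc zero) (control-flow P p s)

  data Reach (P : Program) : Fin (size P) → Tapes → ℕ → Tapes → Set where
    last : ∀ {p ts as} → control-flow P p (scan ts) ≡ (nothing , as) → Reach P p ts 1 (Vec.zipWith act as ts)
    more : ∀ {p p′ ts ts′ as n} → control-flow P p (scan ts) ≡ (just p′ , as) →
           Reach P p′ (Vec.zipWith act as ts) n ts′ → Reach P p ts (suc n) ts′

  act-idle : ∀ {n} (ts : Vec (Tape g) n) → Vec.zipWith act (idle (Vec.map here ts)) ts ≡ ts
  act-idle []       = refl
  act-idle (t ∷ ts) = cong (t ∷_) (act-idle ts)

  reach-second : ∀ {P Q q ts n ts′} → Reach Q q ts n ts′ → Reach (P ⨟ Q) (size P ↑ʳ q) ts n ts′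
  reach-second {P} {Q} {q} {ts} (last eq) = last (trans
    (cong [ _ , (λ q → map₁ (Maybe.map (size P ↑ʳ_)) (control-flow Q q (scan ts))) ]′
      (splitAt-↑ʳ (size P) (size Q) q))
    (cong (map₁ (Maybe.map (size P ↑ʳ_))) eq))
  reach-second {P} {Q} {q} {ts} (more eq reach) = more (trans
    (cong [ _ , (λ q → map₁ (Maybe.map (size P ↑ʳ_)) (control-flow Q q (scan ts))) ]′
      (splitAt-↑ʳ (size P) (size Q) q))
    (cong (map₁ (Maybe.map (size P ↑ʳ_))) eq)) (reach-second reach)

  -- The step that leaves `P` enters `Q` at once, so `last` becomes `more` and composition costs no
  -- extra time.
  reach-first : ∀ {P Q p ts m ts′ n ts″} → Reach P p ts m ts′ → Reach Q (entry Q) ts′ n ts″ →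
    Reach (P ⨟ Q) (p ↑ˡ size Q) ts (m + n) ts″
  reach-first {P} {Q} {p} {ts} (last eq) reach = more (trans
    (cong [ (λ p → map₁ (just ∘ maybe′ (_↑ˡ size Q) (size P ↑ʳ entry Q)) (control-flow P p (scan ts))) , _ ]′
      (splitAt-↑ˡ (size P) p (size Q)))
    (cong (map₁ (just ∘ maybe′ (_↑ˡ size Q) (size P ↑ʳ entry Q))) eq)) (reach-second reach)
  reach-first {P} {Q} {p} {ts} (more eq reach) reach′ = more (trans
    (cong [ (λ p → map₁ (just ∘ maybe′ (_↑ˡ size Q) (size P ↑ʳ entry Q)) (control-flow P p (scan ts))) , _ ]′
      (splitAt-↑ˡ (size P) p (size Q)))
    (cong (map₁ (just ∘ maybe′ (_↑ˡ size Q) (size P ↑ʳ entry Q))) eq)) (reach-first reach reach′)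

  reach-body : ∀ {b P p ts m ts′ n ts″} → Reach P p ts m ts′ → Reach (while b P) zero ts′ n ts″ →
    Reach (while b P) (suc p) ts (m + n) ts″
  reach-body (last eq)       reach  = more (cong (map₁ (just ∘ maybe′ suc zero)) eq) reach
  reach-body (more eq reach) reach′ = more (cong (map₁ (just ∘ maybe′ suc zero)) eq) (reach-body reach reach′)

  exec⇒reach : ∀ {P ts n ts′} → Exec P ts n ts′ → Reach P (entry P) ts n ts′
  exec⇒reach (once refl)       = last refl
  exec⇒reach (e ⨟ e′)          = reach-first (exec⇒reach e) (exec⇒reach e′)
  exec⇒reach {while b P} {ts} (stop eq) =
    subst (Reach (while b P) zero ts 1) (act-idle ts)
      (last (cong (λ c → (if c then just (suc (entry P)) else nothing) , idle (scan ts)) eq))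
  exec⇒reach {while b P} {ts} {ts′ = ts″} (loop {m = m} {n} eq e e′) =
    more (cong (λ c → (if c then just (suc (entry P)) else nothing) , idle (scan ts)) eq)
      (subst (λ us → Reach (while b P) (suc (entry P)) us (m + n) ts″) (sym (act-idle ts))
        (reach-body (exec⇒reach e) (exec⇒reach e′)))

  machine : Program → Machine (suc k)
  machine P = record
    { states = size P
    ; extra  = g
    ; start  = entry P
    ; δ      = λ p s → map₁ (maybe′ run (halt true)) (control-flow P p s)
    }

  module _ (P : Program) where
    open Run (machine P)

    reach⇒iterate : ∀ {p ts n ts′} → Reach P p ts n ts′ → iterate step (config (run p) ts) n ≡ config (halt true) ts′
    reach⇒iterate {ts = ts} (last eq) =
      cong (λ r → config (maybe′ run (halt true) (proj₁ r)) (Vec.zipWith act (proj₂ r) ts)) eq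
    reach⇒iterate {ts = ts} {n = suc n} (more eq reach) = trans
      (cong (λ r → iterate step (config (maybe′ run (halt true) (proj₁ r)) (Vec.zipWith act (proj₂ r) ts)) n) eq)
      (reach⇒iterate reach)

    exec⇒halts : ∀ {w ts n} → Exec P (tapes (initial w)) n ts → after n steps-on w ≡ config (halt true) ts
    exec⇒halts e = reach⇒iterate (exec⇒reach e)

    exec⇒computes : {f : Word → Word} {t s : ℕ → ℕ} →
      (∀ w → ∃[ ts ] Exec P (tapes (initial w)) (t (length w)) ts × Contains (Vec.lookup ts (fromℕ k)) (f w)) →
      (∀ n → t n ≤ s n) → ComputesInTime (machine P) f s
    exec⇒computes {f} {t} runs in-time w with runs w
    ... | ts , exec , contains = t (length w) , in-time (length w) , (true , cong control halts) ,
      subst (λ c → Contains (outputTape c) (f w)) (sym halts) contains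
      where
      halts : after t (length w) steps-on w ≡ config (halt true) ts
      halts = exec⇒halts {w} exec

-- Writing words of polynomial length

-- Each round pays for its test besides the body; the final step is the test that fails.
loopTime : ℕ → ℕ → ℕ
loopTime t zero    = 1
loopTime t (suc n) = suc (t + loopTime t n)

-- The final step is the idle instruction that closes `each`, because there is no empty program.
eachTime : ℕ → ℕ → ℕ
eachTime t zero    = 1
eachTime t (suc n) = t + eachTime t n

module Cursors {g : ℕ} where

  -- Hides the case distinction of `move right`: beyond the listed cells the head stands on a blank.
  cursor : List (Symbol g) → List (Symbol g) → Tape g
  cursor ls []       = tape ls blank []
  cursor ls (x ∷ rs) = tape ls x rs

  right-cursor : ∀ ls x rs → move right (cursor ls (x ∷ rs)) ≡ cursor (x ∷ ls) rs
  right-cursor ls x []      = refl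
  right-cursor ls x (_ ∷ _) = refl

  write-cursor : ∀ y ls rs → act (y , right) (cursor ls rs) ≡ cursor (y ∷ ls) (drop 1 rs)
  write-cursor y ls []           = refl
  write-cursor y ls (x ∷ [])     = refl
  write-cursor y ls (x ∷ _ ∷ rs) = refl

  end-cursor : ∀ y ls rs → act (y , stay) (cursor ls rs) ≡ cursor ls (y ∷ drop 1 rs)
  end-cursor y ls []       = refl
  end-cursor y ls (x ∷ rs) = refl

  rights : ∀ ls vs rs → iterate (move right) (cursor ls (vs ++ rs)) (length vs) ≡ cursor (vs ʳ++ ls) rs
  rights ls []       rs = refl
  rights ls (v ∷ vs) rs rewrite right-cursor ls v (vs ++ rs) = rights (v ∷ ls) vs rs

  lefts : ∀ vs ls r rs → iterate (move left) (cursor (vs ++ ls) (r ∷ rs)) (length vs) ≡ cursor ls (vs ʳ++ (r ∷ rs))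
  lefts []       ls r rs = refl
  lefts (v ∷ vs) ls r rs = lefts vs ls v (r ∷ rs)

  there-and-back : ∀ ls vs r rs → let t = cursor ls (vs ++ r ∷ rs) in
    iterate (move left) (iterate (move right) t (length vs)) (length vs) ≡ t
  there-and-back ls vs r rs = begin
    iterate (move left) (iterate (move right) (cursor ls (vs ++ r ∷ rs)) (length vs)) (length vs)
      ≡⟨ cong (λ t → iterate (move left) t (length vs)) (rights ls vs (r ∷ rs)) ⟩
    iterate (move left) (cursor (vs ʳ++ ls) (r ∷ rs)) (length vs)
      ≡⟨ cong₂ (λ us n → iterate (move left) (cursor us (r ∷ rs)) n) (ʳ++-defn vs) (sym (length-reverse vs)) ⟩
    iterate (move left) (cursor (reverse vs ++ ls) (r ∷ rs)) (length (reverse vs))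
      ≡⟨ lefts (reverse vs) ls r rs ⟩
    cursor ls (reverse vs ʳ++ (r ∷ rs))
      ≡⟨ cong (cursor ls) (ʳ++-ʳ++ vs) ⟩
    cursor ls (vs ++ r ∷ rs) ∎
    where open ≡-Reasoning

open Cursors

module Printing (γ : ℕ) where

  -- The extra symbols are two end markers, four names for the values of `Rel`, and one code for
  -- each of the `γ` letters of the automaton.
  open Programs 4 (2 + (4 + γ)) public

  Track : Set
  Track = Tape (2 + (4 + γ))

  Sym : Set
  Sym = Symbol (2 + (4 + γ))

  Letter : Set
  Letter = Fin (4 + γ)

  -- Tape I holds the input, O the output; X and Y hold two copies of the current
  -- word, Z is written by loops over the others.  Words lie between `lm` and `rm`.
  pattern lm       = aux zero
  pattern rm       = aux (suc zero)
  pattern letter a = aux (suc (suc a))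

  pattern farₗ  = zero
  pattern prevₗ = suc zero
  pattern curₗ  = suc (suc zero)
  pattern nextₗ = suc (suc (suc zero))
  pattern code a = suc (suc (suc (suc a)))

  not-lm not-rm not-blank not-prev : Sym → Bool
  not-lm lm = false
  not-lm _  = true
  not-rm rm = false
  not-rm _  = true
  not-blank blank = false
  not-blank _     = true
  not-prev (letter prevₗ) = false
  not-prev _              = true

  keep : Sym → Sym × Move
  keep x = x , stay

  on : (Sym → Sym → Sym → Sym → Sym → Actions) → Program
  on f = once λ { (i ∷ x ∷ y ∷ z ∷ o ∷ []) → f i x y z o }

  go : Move → Move → Move → Move → Program
  go mi mx my mz = on λ i x y z o → (i , mi) ∷ (x , mx) ∷ (y , my) ∷ (z , mz) ∷ keep o ∷ []

  putZ : Sym → Program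
  putZ c = on λ i x y z o → keep i ∷ keep x ∷ keep y ∷ (c , right) ∷ keep o ∷ []

  pattern tapeI = zero
  pattern tapeX = suc zero
  pattern tapeY = suc (suc zero)
  pattern tapeZ = suc (suc (suc zero))

  ready : List Sym → Track
  ready rs = tape [] lm rs

  -- A tape in append mode; what follows the head is to be overwritten.
  opened : List Letter → List Sym → Track
  opened ls js = cursor (map (λ a → letter a) ls ++ lm ∷ []) js

  push : Sym → Track → Track
  push c = act (c , right)

  module Marked {A : Set} (e : A → Sym)
    (e-lm : ∀ a → not-lm (e a) ≡ true) (e-rm : ∀ a → not-rm (e a) ≡ true) where

    -- The list `js` to the right of `rm` is what earlier contents have left behind: cells are never
    -- removed, so it has to be carried along.
    mid : List A → List A → List Sym → Track
    mid ls zs js = cursor (map e ls ++ lm ∷ []) (map e zs ++ rm ∷ js)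

    rest : List A → List Sym → Track
    rest zs js = ready (map e zs ++ rm ∷ js)

    enter : ∀ zs js → move right (rest zs js) ≡ mid [] zs js
    enter []      js = refl
    enter (_ ∷ _) js = refl

    retreat : ∀ l ls zs js → move left (mid (l ∷ ls) zs js) ≡ mid ls (l ∷ zs) js
    retreat l ls []      js = refl
    retreat l ls (_ ∷ _) js = refl

    leave : ∀ zs js → move left (mid [] zs js) ≡ rest zs js
    leave []      js = refl
    leave (_ ∷ _) js = refl

    mid-lm : ∀ ls zs js → not-lm (here (mid ls zs js)) ≡ true
    mid-lm ls []      js = refl
    mid-lm ls (z ∷ _) js = e-lm z

    module _ {S : Set} (s : S → Track → Tapes) {b : Scan → Bool} {P : Program} {n : ℕ} where

      -- The map `s` inserts the moving track and an accumulator into the five tapes, so the same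
      -- statement serves every tape and every side effect of the loop. The extra round is the move
      -- onto `lm`.
      backward : (upd : S → S) → (∀ a T → b (scan (s a T)) ≡ not-lm (here T)) →
        (∀ a T → Exec P (s a T) n (s (upd a) (move left T))) → ∀ a ls zs js →
        Exec (while b P) (s a (mid ls zs js)) (loopTime n (suc (length ls)))
          (s (iterate upd a (suc (length ls))) (rest (ls ʳ++ zs) js))
      backward upd test body a [] zs js = loop (trans (test a _) (mid-lm [] zs js))
        (subst (λ T → Exec P (s a (mid [] zs js)) n (s (upd a) T)) (leave zs js) (body a _)) (stop (test (upd a) _))
      backward upd test body a (l ∷ ls) zs js = loop (trans (test a _) (mid-lm (l ∷ ls) zs js))
        (subst (λ T → Exec P (s a (mid (l ∷ ls) zs js)) n (s (upd a) T)) (retreat l ls zs js) (body a _))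
        (backward upd test body (upd a) ls (l ∷ zs) js)

      rewind : (upd : S → S) → (∀ a T → b (scan (s a T)) ≡ not-lm (here T)) →
        (∀ a T → Exec P (s a T) n (s (upd a) (move left T))) → ∀ a zs js →
        Exec (while b P) (s a (mid (reverse zs) [] js)) (loopTime n (suc (length zs)))
          (s (iterate upd a (suc (length zs))) (rest zs js))
      rewind upd test body a zs js = subst₂ (λ k us → Exec (while b P) (s a (mid (reverse zs) [] js))
          (loopTime n (suc k)) (s (iterate upd a (suc k)) (rest us js)))
        (length-reverse zs) (reverse-involutive zs) (backward upd test body a (reverse zs) [] js)

      forward : (upd : S → Sym → S) → (∀ a T → b (scan (s a T)) ≡ not-rm (here T)) →
        (∀ a T → Exec P (s a T) n (s (upd a (here T)) (move right T))) → ∀ a ls zs js →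
        Exec (while b P) (s a (mid ls zs js)) (loopTime n (length zs))
          (s (foldl (λ a z → upd a (e z)) a zs) (mid (zs ʳ++ ls) [] js))
      forward upd test body a ls []       js = stop (test a _)
      forward upd test body a ls (z ∷ zs) js = loop (trans (test a _) (e-rm z))
        (subst (λ T → Exec P (s a (mid ls (z ∷ zs) js)) n (s (upd a (e z)) T)) (right-cursor _ (e z) _) (body a _))
        (forward upd test body (upd a (e z)) (z ∷ ls) zs js)

  open Marked (λ a → letter a) (λ _ → refl) (λ _ → refl)
  module Input = Marked bit (λ _ → refl) (λ _ → refl)

  until : (Sym → Bool) → Fin 5 → Program → Program
  until p i = while λ s → p (Vec.lookup s i)

  rewindI rewindX rewindY rewindZ : Program
  rewindI = until not-lm tapeI (go left stay stay stay)
  rewindX = until not-lm tapeX (go stay left stay stay)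
  rewindY = until not-lm tapeY (go stay stay left stay)
  rewindZ = until not-lm tapeZ (go stay stay stay left)

  -- The word on the tape serves as a unary loop counter, and its own head as the loop variable;
  -- nesting the two loops is how lengths get multiplied.
  forX forY : Program → Program
  forX P = go stay right stay stay ⨟ until not-rm tapeX (P ⨟ go stay right stay stay) ⨟ rewindX
  forY P = go stay stay right stay ⨟ until not-rm tapeY (P ⨟ go stay stay right stay) ⨟ rewindY

  forTime : ℕ → ℕ → ℕ
  forTime t n = 1 + (loopTime (t + 1) n + loopTime 1 (suc n))

  foldl-iterate : ∀ {A B : Set} (f : A → A) a (bs : List B) → foldl (λ a _ → f a) a bs ≡ iterate f a (length bs)
  foldl-iterate f a []       = refl
  foldl-iterate f a (_ ∷ bs) = foldl-iterate f (f a) bs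

  module _ {P : Program} {t : ℕ} (F : Track → Track) {i o : Track} where

    forX-exec : ∀ {y} → (∀ x z → Exec P (i ∷ x ∷ y ∷ z ∷ o ∷ []) t (i ∷ x ∷ y ∷ F z ∷ o ∷ [])) → ∀ zs js z →
      Exec (forX P) (i ∷ rest zs js ∷ y ∷ z ∷ o ∷ []) (forTime t (length zs))
        (i ∷ rest zs js ∷ y ∷ iterate F z (length zs) ∷ o ∷ [])
    forX-exec {y} body zs js z =
      once (cong (λ x → i ∷ x ∷ y ∷ z ∷ o ∷ []) (enter zs js)) ⨟
      forward (λ z x → i ∷ x ∷ y ∷ z ∷ o ∷ []) (λ z _ → F z) (λ _ _ → refl) (λ z x → body x z ⨟ once refl) z
        [] zs js ⨟
      subst (λ z′ → Exec rewindX (i ∷ mid (reverse zs) [] js ∷ y ∷ z′ ∷ o ∷ []) (loopTime 1 (suc (length zs)))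
          (i ∷ rest zs js ∷ y ∷ iterate F z (length zs) ∷ o ∷ []))
        (sym (foldl-iterate F z zs))
        (rewind (λ _ x → i ∷ x ∷ y ∷ iterate F z (length zs) ∷ o ∷ []) (λ a → a) (λ _ _ → refl)
          (λ _ _ → once refl) z zs js)

    forY-exec : ∀ {x} → (∀ y z → Exec P (i ∷ x ∷ y ∷ z ∷ o ∷ []) t (i ∷ x ∷ y ∷ F z ∷ o ∷ [])) → ∀ zs js z →
      Exec (forY P) (i ∷ x ∷ rest zs js ∷ z ∷ o ∷ []) (forTime t (length zs))
        (i ∷ x ∷ rest zs js ∷ iterate F z (length zs) ∷ o ∷ [])
    forY-exec {x} body zs js z =
      once (cong (λ y → i ∷ x ∷ y ∷ z ∷ o ∷ []) (enter zs js)) ⨟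
      forward (λ z y → i ∷ x ∷ y ∷ z ∷ o ∷ []) (λ z _ → F z) (λ _ _ → refl) (λ z y → body y z ⨟ once refl) z
        [] zs js ⨟
      subst (λ z′ → Exec rewindY (i ∷ x ∷ mid (reverse zs) [] js ∷ z′ ∷ o ∷ []) (loopTime 1 (suc (length zs)))
          (i ∷ x ∷ rest zs js ∷ iterate F z (length zs) ∷ o ∷ []))
        (sym (foldl-iterate F z zs))
        (rewind (λ _ y → i ∷ x ∷ y ∷ iterate F z (length zs) ∷ o ∷ []) (λ a → a) (λ _ _ → refl)
          (λ _ _ → once refl) z zs js)

  feed : List Letter → Track → Track
  feed cs t = foldl (λ t c → push (letter c) t) t cs

  feed-opened : ∀ cs ls js → feed cs (opened ls js) ≡ opened (cs ʳ++ ls) (iterate (drop 1) js (length cs))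
  feed-opened []       ls js = refl
  feed-opened (c ∷ cs) ls js rewrite write-cursor (letter c) (map (λ a → letter a) ls ++ lm ∷ []) js =
    feed-opened cs (c ∷ ls) (drop 1 js)

  ready-opened : ∀ rs → move right (ready rs) ≡ opened [] rs
  ready-opened []      = refl
  ready-opened (_ ∷ _) = refl

  end-opened : ∀ ls js → act (rm , stay) (opened ls js) ≡ mid ls [] (drop 1 js)
  end-opened ls js = end-cursor rm _ js

  closeZ copy : Program
  closeZ = on (λ i x y z o → keep i ∷ keep x ∷ keep y ∷ keep rm ∷ keep o ∷ []) ⨟ rewindZ
  copy =
    go stay right right right ⨟
    until not-rm tapeZ (on λ i x y z o → keep i ∷ (z , right) ∷ (z , right) ∷ (z , right) ∷ keep o ∷ []) ⨟
    on (λ i x y z o → keep i ∷ keep rm ∷ keep rm ∷ keep z ∷ keep o ∷ []) ⨟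
    rewindX ⨟ rewindY ⨟ rewindZ

  closeTime copyTime : ℕ → ℕ
  closeTime n = 1 + loopTime 1 (suc n)
  copyTime n = 1 + (loopTime 1 n + (1 + (loopTime 1 (suc n) + (loopTime 1 (suc n) + loopTime 1 (suc n)))))

  closeZ-exec : ∀ {i x y o} zs js → ∃[ js′ ]
    Exec closeZ (i ∷ x ∷ y ∷ opened (reverse zs) js ∷ o ∷ []) (closeTime (length zs))
      (i ∷ x ∷ y ∷ rest zs js′ ∷ o ∷ [])
  closeZ-exec {i} {x} {y} {o} zs js = drop 1 js ,
    (once (cong (λ z → i ∷ x ∷ y ∷ z ∷ o ∷ []) (end-opened (reverse zs) js)) ⨟
     rewind (λ _ z → i ∷ x ∷ y ∷ z ∷ o ∷ []) (λ a → a) (λ _ _ → refl) (λ _ _ → once refl) js zs (drop 1 js))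

  copy-exec : ∀ {i o} zs jx jy jz → ∃[ jx′ ] ∃[ jy′ ]
    Exec copy (i ∷ ready jx ∷ ready jy ∷ rest zs jz ∷ o ∷ []) (copyTime (length zs))
      (i ∷ rest zs jx′ ∷ rest zs jy′ ∷ rest zs jz ∷ o ∷ [])
  copy-exec {i} {o} zs jx jy jz = drop 1 (js jx) , drop 1 (js jy) ,
    (once (trans (cong₂ (λ x y → i ∷ x ∷ y ∷ move right (rest zs jz) ∷ o ∷ []) (ready-opened jx) (ready-opened jy))
        (cong (λ z → i ∷ opened [] jx ∷ opened [] jy ∷ z ∷ o ∷ []) (enter zs jz))) ⨟
     forward (λ (x , y) z → i ∷ x ∷ y ∷ z ∷ o ∷ []) (λ (x , y) c → push c x , push c y) (λ _ _ → refl)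
       (λ _ _ → once refl)
       (opened [] jx , opened [] jy) [] zs jz ⨟
     once (trans (cong (λ (x , y) → i ∷ act (keep rm) x ∷ act (keep rm) y ∷ mid (reverse zs) [] jz ∷ o ∷ [])
       (copied zs (opened [] jx) (opened [] jy)))
       (cong₂ (λ x y → i ∷ x ∷ y ∷ mid (reverse zs) [] jz ∷ o ∷ []) (ended jx) (ended jy))) ⨟
     rewind (λ _ x → i ∷ x ∷ mid (reverse zs) [] (drop 1 (js jy)) ∷ mid (reverse zs) [] jz ∷ o ∷ []) (λ a → a)
       (λ _ _ → refl) (λ _ _ → once refl) jx zs (drop 1 (js jx)) ⨟
     rewind (λ _ y → i ∷ rest zs (drop 1 (js jx)) ∷ y ∷ mid (reverse zs) [] jz ∷ o ∷ []) (λ a → a)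
       (λ _ _ → refl) (λ _ _ → once refl) jx zs (drop 1 (js jy)) ⨟
     rewind (λ _ z → i ∷ rest zs (drop 1 (js jx)) ∷ rest zs (drop 1 (js jy)) ∷ z ∷ o ∷ []) (λ a → a)
       (λ _ _ → refl) (λ _ _ → once refl) jx zs jz)
    where
    js : List Sym → List Sym
    js j = iterate (drop 1) j (length zs)
    copied : ∀ zs x y → foldl (λ (x , y) c → push (letter c) x , push (letter c) y) (x , y) zs ≡
      (feed zs x , feed zs y)
    copied []       x y = refl
    copied (z ∷ zs) x y = copied zs (push (letter z) x) (push (letter z) y)
    ended : ∀ j → act (keep rm) (feed zs (opened [] j)) ≡ mid (reverse zs) [] (drop 1 (js j))
    ended j = trans (cong (act (keep rm)) (feed-opened zs [] j)) (end-opened (reverse zs) (js j))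

  retime : ∀ {P ts ts′ m n} → m ≡ n → Exec P ts m ts′ → Exec P ts n ts′
  retime refl e = e

  -- Unrolled when the program is built, for counts independent of the input; therefore the index
  -- may select different code in each round.
  each : ∀ n → (Fin n → Program) → Program
  each zero    P = go stay stay stay stay
  each (suc n) P = P zero ⨟ each n (P ∘ suc)

  module _ {i x y z : Track} where

    -- Output is only appended, so `L` is the reverse of what has been printed and the head waits on
    -- the next blank.
    printed : List Bit → Tapes
    printed L = i ∷ x ∷ y ∷ z ∷ tape (map bit L) blank [] ∷ []

    each-exec : ∀ {t} n (P : Fin n → Program) (out : Fin n → List Bit) →
      (∀ b L → Exec (P b) (printed L) t (printed (out b ʳ++ L))) → ∀ L →
      Exec (each n P) (printed L) (eachTime t n) (printed (concat (tabulate out) ʳ++ L))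
    each-exec zero    P out body L = once refl
    each-exec {t} (suc n) P out body L = subst (Exec (each (suc n) P) (printed L) (eachTime t (suc n)) ∘ printed)
      (sym (++-ʳ++ (out zero))) (body zero L ⨟ each-exec n (P ∘ suc) (out ∘ suc) (body ∘ suc) (out zero ʳ++ L))

  feed-++ : ∀ bs cs t → feed (bs ++ cs) t ≡ feed cs (feed bs t)
  feed-++ bs cs t = foldl-++ (λ t c → push (letter c) t) t bs cs

  iterate-feed : ∀ cs n t → iterate (feed cs) t n ≡ feed (concat (replicate n cs)) t
  iterate-feed cs zero    t = refl
  iterate-feed cs (suc n) t = trans (iterate-feed cs n (feed cs t)) (sym (feed-++ cs (concat (replicate n cs)) t))

  module _ {P : Program} {t : ℕ} (cs : List Letter) {i o : Track} where

    forX-feed : ∀ {y} → (∀ x z → Exec P (i ∷ x ∷ y ∷ z ∷ o ∷ []) t (i ∷ x ∷ y ∷ feed cs z ∷ o ∷ [])) → ∀ zs js z →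
      Exec (forX P) (i ∷ rest zs js ∷ y ∷ z ∷ o ∷ []) (forTime t (length zs))
        (i ∷ rest zs js ∷ y ∷ feed (concat (replicate (length zs) cs)) z ∷ o ∷ [])
    forX-feed {y} body zs js z =
      subst (λ z′ → Exec (forX P) (i ∷ rest zs js ∷ y ∷ z ∷ o ∷ []) (forTime t (length zs))
        (i ∷ rest zs js ∷ y ∷ z′ ∷ o ∷ []))
        (iterate-feed cs (length zs) z) (forX-exec (feed cs) body zs js z)

    forY-feed : ∀ {x} → (∀ y z → Exec P (i ∷ x ∷ y ∷ z ∷ o ∷ []) t (i ∷ x ∷ y ∷ feed cs z ∷ o ∷ [])) → ∀ zs js z →
      Exec (forY P) (i ∷ x ∷ rest zs js ∷ z ∷ o ∷ []) (forTime t (length zs))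
        (i ∷ x ∷ rest zs js ∷ feed (concat (replicate (length zs) cs)) z ∷ o ∷ [])
    forY-feed {x} body zs js z =
      subst (λ z′ → Exec (forY P) (i ∷ x ∷ rest zs js ∷ z ∷ o ∷ []) (forTime t (length zs))
        (i ∷ x ∷ rest zs js ∷ z′ ∷ o ∷ []))
        (iterate-feed cs (length zs) z) (forY-exec (feed cs) body zs js z)

  length-concat-replicate : ∀ {A : Set} n (cs : List A) → length (concat (replicate n cs)) ≡ n * length cs
  length-concat-replicate zero    cs = refl
  length-concat-replicate (suc n) cs = trans (length-++ cs) (cong (length cs +_) (length-concat-replicate n cs))

  finish : Program
  finish = closeZ ⨟ copy

  finishTime : ℕ → ℕ
  finishTime n = closeTime n + copyTime n

  -- The state between two phases: equal words at rest on X and Y, nothing printed yet, and a track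
  -- Z whose contents may be overwritten.
  Twins : Track → List Letter → Tapes → Set
  Twins i zs ts = ∃[ jx ] ∃[ jy ] ∃[ jz ] ts ≡ i ∷ rest zs jx ∷ rest zs jy ∷ ready jz ∷ tape [] blank [] ∷ []

  finish-exec : ∀ {i} cs jx jy jz → ∃[ ts ] Twins i cs ts ×
    Exec finish (i ∷ ready jx ∷ ready jy ∷ feed cs (opened [] jz) ∷ tape [] blank [] ∷ []) (finishTime (length cs)) ts
  finish-exec {i} cs jx jy jz rewrite feed-opened cs [] jz
    with closeZ-exec {i} {ready jx} {ready jy} {tape [] blank []} cs (iterate (drop 1) jz (length cs))
  ... | jz′ , closes with copy-exec {i} {tape [] blank []} cs jx jy jz′
  ... | jx′ , jy′ , copies = _ , (jx′ , jy′ , _ , refl) , closes ⨟ copies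

  square : Program
  square = go stay stay stay right ⨟ forX (forY (putZ (letter farₗ))) ⨟ finish

  squareTime : ℕ → ℕ
  squareTime m = 1 + (forTime (forTime 1 m) m + finishTime (m * m))

  square-exec : ∀ {i zs ts} → Twins i zs ts → ∃[ zs′ ] ∃[ ts′ ]
    length zs′ ≡ length zs * length zs × Twins i zs′ ts′ × Exec square ts (squareTime (length zs)) ts′
  square-exec {i} {zs} (jx , jy , jz , refl)
    with finish-exec {i} (concat (replicate (length zs) (concat (replicate (length zs) (farₗ ∷ [])))))
      (map (λ a → letter a) zs ++ rm ∷ jx) (map (λ a → letter a) zs ++ rm ∷ jy) jz
  ... | ts′ , twins , finishes = cs , ts′ , len , twins ,
    (once (cong (λ z → i ∷ rest zs jx ∷ rest zs jy ∷ z ∷ tape [] blank [] ∷ []) (ready-opened jz)) ⨟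
     forX-feed (concat (replicate (length zs) (farₗ ∷ [])))
       (λ x z → forY-feed (farₗ ∷ []) (λ y z → once refl) zs jy z) zs jx (opened [] jz) ⨟
     retime (cong finishTime len) finishes)
    where
    cs = concat (replicate (length zs) (concat (replicate (length zs) (farₗ ∷ []))))
    len : length cs ≡ length zs * length zs
    len = trans (length-concat-replicate (length zs) _)
      (cong (length zs *_) (trans (length-concat-replicate (length zs) _) (*-identityʳ _)))

  -- Squaring `d` times raises the length to the power `2 ^ d`, which exceeds the degree `d` of the
  -- space bound.
  grow : ℕ → Program
  grow zero    = go stay stay stay stay
  grow (suc d) = square ⨟ grow d

  growTime : ℕ → ℕ → ℕ
  growTime zero    m = 1
  growTime (suc d) m = squareTime m + growTime d (m * m)

  grow-exec : ∀ d {i zs ts} → Twins i zs ts → ∃[ zs′ ] ∃[ ts′ ]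
    length zs′ ≡ iterate (λ m → m * m) (length zs) d × Twins i zs′ ts′ × Exec (grow d) ts (growTime d (length zs)) ts′
  grow-exec zero    {i} {zs} {ts} twins@(_ , _ , _ , refl) = zs , ts , refl , twins , once refl
  grow-exec (suc d) {i} {zs} twins with square-exec twins
  ... | zs₁ , ts₁ , len₁ , twins₁ , squares with grow-exec d twins₁
  ...   | zs₂ , ts₂ , len₂ , twins₂ , grows = zs₂ , ts₂ ,
    trans len₂ (cong (λ m → iterate (λ m → m * m) m d) len₁) , twins₂ ,
    squares ⨟ subst (λ m → Exec (grow d) ts₁ (growTime d m) ts₂) len₁ grows

  extendXY : Move → Program
  extendXY m = on λ i x y z o → (i , m) ∷ (letter farₗ , right) ∷ (letter farₗ , right) ∷ keep z ∷ keep o ∷ []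

  setup : ℕ → Program
  setup k =
    on (λ i x y z o → (i , left) ∷ (lm , right) ∷ (lm , right) ∷ (lm , right) ∷ keep o ∷ []) ⨟
    on (λ i x y z o → (lm , right) ∷ keep x ∷ keep y ∷ keep z ∷ keep o ∷ []) ⨟
    each k (λ _ → extendXY stay) ⨟
    until not-blank tapeI (extendXY right) ⨟
    on (λ i x y z o → keep rm ∷ keep rm ∷ keep rm ∷ (z , left) ∷ keep o ∷ []) ⨟
    rewindI ⨟ rewindX ⨟ rewindY

  setupTime : ℕ → ℕ → ℕ
  setupTime k n = 1 + (1 + (eachTime 1 k +
    (loopTime 1 n + (1 + (loopTime 1 (suc n) + (loopTime 1 (suc (k + n)) + loopTime 1 (suc (k + n))))))))

  module _ {z o : Track} where

    extend-exec : ∀ k {i} x y → Exec (each k (λ _ → extendXY stay)) (i ∷ x ∷ y ∷ z ∷ o ∷ []) (eachTime 1 k)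
      (i ∷ feed (replicate k farₗ) x ∷ feed (replicate k farₗ) y ∷ z ∷ o ∷ [])
    extend-exec zero    x y = once refl
    extend-exec (suc k) x y = once refl ⨟ extend-exec k (push (letter farₗ) x) (push (letter farₗ) y)

    input-exec : ∀ ls bs k x y → Exec (until not-blank tapeI (extendXY right))
      (cursor (map bit ls ++ lm ∷ []) (map bit bs ++ replicate k blank) ∷ x ∷ y ∷ z ∷ o ∷ []) (loopTime 1 (length bs))
      (cursor (map bit (bs ʳ++ ls) ++ lm ∷ []) (replicate k blank) ∷ feed (replicate (length bs) farₗ) x ∷
        feed (replicate (length bs) farₗ) y ∷ z ∷ o ∷ [])
    input-exec ls []       zero    x y = stop refl
    input-exec ls []       (suc k) x y = stop refl
    input-exec ls (b ∷ bs) k       x y =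
      loop refl (once (cong (λ i → i ∷ push (letter farₗ) x ∷ push (letter farₗ) y ∷ z ∷ o ∷ [])
        (right-cursor _ (bit b) _)))
        (input-exec (b ∷ ls) bs k (push (letter farₗ) x) (push (letter farₗ) y))

  initial-tapes : Word → Tapes
  initial-tapes w = fromList (map bit w) ∷ Vec.replicate 4 (fromList [])

  setup-exec : ∀ k w → ∃[ ji ] ∃[ zs ] ∃[ ts ]
    length zs ≡ k + length w × Twins (Input.rest w ji) zs ts ×
      Exec (setup k) (initial-tapes w) (setupTime k (length w)) ts
  setup-exec k w = ji , zs , _ , len , (js , js , blank ∷ [] , refl) ,
    (once (cong (λ i → i ∷ opened [] [] ∷ opened [] [] ∷ opened [] [] ∷ o ∷ []) (left-initial w)) ⨟
     once (cong (λ i → i ∷ opened [] [] ∷ opened [] [] ∷ opened [] [] ∷ o ∷ [])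
       (write-cursor lm [] (blank ∷ map bit w ++ replicate p blank))) ⨟
     extend-exec k (opened [] []) (opened [] []) ⨟
     input-exec [] w p _ _ ⨟
     once (cong₂ (λ i x → i ∷ x ∷ x ∷ ready (blank ∷ []) ∷ o ∷ []) (end-cursor rm _ (replicate p blank)) ended) ⨟
     Input.rewind (λ _ i → i ∷ mid (reverse zs) [] js ∷ mid (reverse zs) [] js ∷ ready (blank ∷ []) ∷ o ∷ [])
       (λ a → a) (λ _ _ → refl) (λ _ _ → once refl) js w ji ⨟
     retime (cong (λ n → loopTime 1 (suc n) + loopTime 1 (suc n)) len)
       (rewind (λ _ x → Input.rest w ji ∷ x ∷ mid (reverse zs) [] js ∷ ready (blank ∷ []) ∷ o ∷ []) (λ a → a)
         (λ _ _ → refl) (λ _ _ → once refl) js zs js ⨟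
        rewind (λ _ y → Input.rest w ji ∷ rest zs js ∷ y ∷ ready (blank ∷ []) ∷ o ∷ []) (λ a → a)
          (λ _ _ → refl) (λ _ _ → once refl) js zs js))
    where
    o : Track
    o = tape [] blank []
    -- On empty input the head starts on a blank, which stays behind as a listed cell after the move
    -- to the left.
    spare : Word → ℕ
    spare []      = 1
    spare (_ ∷ _) = 0
    p = spare w
    left-initial : ∀ w → move left (fromList (map bit w)) ≡ cursor [] (blank ∷ map bit w ++ replicate (spare w) blank)
    left-initial []       = refl
    left-initial (b ∷ bs) = cong (λ rs → tape [] blank (bit b ∷ rs)) (sym (++-identityʳ (map bit bs)))
    ji : List Sym
    ji = drop 1 (replicate p blank)
    zs : List Letter
    zs = replicate k farₗ ++ replicate (length w) farₗ
    js : List Sym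
    js = drop 1 (iterate (drop 1) [] (length zs))
    len : length zs ≡ k + length w
    len = trans (length-++ (replicate k farₗ)) (cong₂ _+_ (length-replicate k) (length-replicate (length w)))
    ended : act (rm , stay) (feed (replicate (length w) farₗ) (feed (replicate k farₗ) (opened [] []))) ≡
      mid (reverse zs) [] js
    ended = trans (cong (act (rm , stay))
      (trans (sym (feed-++ (replicate k farₗ) (replicate (length w) farₗ) (opened [] [])))
      (feed-opened zs [] []))) (end-opened (reverse zs) (iterate (drop 1) [] (length zs)))

-- Printing a game

module Output (γ : ℕ) where

  open Printing γ public
  open Marked (λ a → letter a) (λ _ → refl) (λ _ → refl) public

  ending : ∀ {P ts n ts′ ts″} → ts′ ≡ ts″ → Exec P ts n ts′ → Exec P ts n ts″
  ending refl e = e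

  concat-replicate-[_] : ∀ {A : Set} (c : A) n → concat (replicate n (c ∷ [])) ≡ replicate n c
  concat-replicate-[ c ] zero    = refl
  concat-replicate-[ c ] (suc n) = cong (c ∷_) (concat-replicate-[ c ] n)

  forX-put : ∀ c {i y o} zs js z →
    Exec (forX (putZ (letter c))) (i ∷ rest zs js ∷ y ∷ z ∷ o ∷ []) (forTime 1 (length zs))
    (i ∷ rest zs js ∷ y ∷ feed (replicate (length zs) c) z ∷ o ∷ [])
  forX-put c {i} {y} {o} zs js z =
    subst (λ cs → Exec (forX (putZ (letter c))) (i ∷ rest zs js ∷ y ∷ z ∷ o ∷ []) (forTime 1 (length zs))
    (i ∷ rest zs js ∷ y ∷ feed cs z ∷ o ∷ []))
    (concat-replicate-[ c ] (length zs)) (forX-feed (c ∷ []) (λ _ _ → once refl) zs js z)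

  module Layout (border pad : Letter) (lead : Maybe Bit → Letter) (follow : Bit → Letter) where

    leadOf : Sym → Letter
    leadOf (bit b) = lead (just b)
    leadOf _       = lead nothing

    followOf : Sym → Letter
    followOf (bit b) = follow b
    followOf _       = pad

    -- On empty input the head is already on `rm` and must not run past it, although the letter
    -- carrying the machine's head still has to be written.
    skip : Sym → Sym × Move
    skip rm = rm , stay
    skip x  = x , right

    centre : Word → List Letter
    centre []       = lead nothing ∷ []
    centre (b ∷ bs) = lead (just b) ∷ map follow bs

    configuration : Word → ℕ → List Letter
    configuration w a = (border ∷ []) ++ (replicate a pad ++ (centre w ++ (replicate a pad ++ (border ∷ []))))

    putCentre : Program
    putCentre =
      on (λ i x y z o → skip i ∷ keep x ∷ keep y ∷ (letter (leadOf i) , right) ∷ keep o ∷ []) ⨟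
      until not-rm tapeI (on λ i x y z o → (i , right) ∷ keep x ∷ keep y ∷ (letter (followOf i) , right) ∷
        keep o ∷ [])

    layOut : Program
    layOut =
      on (λ i x y z o → (i , right) ∷ keep x ∷ keep y ∷ (z , right) ∷ keep o ∷ []) ⨟
      putZ (letter border) ⨟ forX (putZ (letter pad)) ⨟ putCentre ⨟ forX (putZ (letter pad)) ⨟
        putZ (letter border) ⨟ finish

    centreTime : ℕ → ℕ
    centreTime n = 1 + loopTime 1 (n ∸ 1)

    -- The summand `suc (n ∸ 1)` is the length of the centre: even an empty input occupies the cell
    -- under the head.
    width : ℕ → ℕ → ℕ
    width n a = 1 + (a + (suc (n ∸ 1) + (a + 1)))

    layOutTime : ℕ → ℕ → ℕ
    layOutTime n a = 1 + (1 + (forTime 1 a + (centreTime n + (forTime 1 a + (1 + finishTime (width n a))))))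

    centre-exec : ∀ {x y o} w ji z → Exec putCentre (Input.mid [] w ji ∷ x ∷ y ∷ z ∷ o ∷ []) (centreTime (length w))
      (Input.mid (reverse w) [] ji ∷ x ∷ y ∷ feed (centre w) z ∷ o ∷ [])
    centre-exec             []       ji z = once refl ⨟ stop refl
    centre-exec {x} {y} {o} (b ∷ bs) ji z =
      once (cong (λ i → i ∷ x ∷ y ∷ push (letter (lead (just b))) z ∷ o ∷ []) (right-cursor _ (bit b) _)) ⨟
      subst (λ t → Exec _ (Input.mid (b ∷ []) bs ji ∷ x ∷ y ∷ push (letter (lead (just b))) z ∷ o ∷ [])
        (loopTime 1 (length bs)) (Input.mid (reverse (b ∷ bs)) [] ji ∷ x ∷ y ∷ t ∷ o ∷ []))
        (sym (foldl-map (λ t c → push (letter c) t) follow (push (letter (lead (just b))) z) bs))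
        (Input.forward (λ z i → i ∷ x ∷ y ∷ z ∷ o ∷ []) (λ z c → push (letter (followOf c)) z) (λ _ _ → refl)
          (λ _ _ → once refl)
          (push (letter (lead (just b))) z) (b ∷ []) bs ji)

    length-centre : ∀ w → length (centre w) ≡ suc (length w ∸ 1)
    length-centre []       = refl
    length-centre (b ∷ bs) = cong suc (length-map follow bs)

    length-configuration : ∀ w a → length (configuration w a) ≡ width (length w) a
    length-configuration w a = cong suc (trans (length-++ (replicate a pad)) (cong₂ _+_ (length-replicate a)
      (trans (length-++ (centre w)) (cong₂ _+_ (length-centre w)
        (trans (length-++ (replicate a pad)) (cong (_+ 1) (length-replicate a)))))))

    layOut-exec : ∀ {w ji zs ts a} → length zs ≡ a → Twins (Input.rest w ji) zs ts → ∃[ i ] ∃[ ts′ ]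
      Twins i (configuration w a) ts′ × Exec layOut ts (layOutTime (length w) a) ts′
    layOut-exec {w} {ji} {zs} refl (jx , jy , jz , refl)
      with finish-exec {Input.mid (reverse w) [] ji} (configuration w (length zs))
        (map (λ a → letter a) zs ++ rm ∷ jx) (map (λ a → letter a) zs ++ rm ∷ jy) jz
    ... | ts′ , twins , finishes = _ , ts′ , twins ,
      (once (cong₂ (λ i z → i ∷ rest zs jx ∷ rest zs jy ∷ z ∷ tape [] blank [] ∷ []) (Input.enter w ji)
        (ready-opened jz)) ⨟
       once refl ⨟ forX-put pad zs jx _ ⨟ centre-exec w ji _ ⨟ forX-put pad zs jx _ ⨟ once refl ⨟
       subst (λ z → Exec finish (Input.mid (reverse w) [] ji ∷ rest zs jx ∷ rest zs jy ∷ z ∷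
         tape [] blank [] ∷ []) (finishTime (width (length w) (length zs))) ts′)
         fed (retime (cong finishTime (length-configuration w (length zs))) finishes))
      where
      a = replicate (length zs) pad
      z₀ = opened [] jz
      fed : feed (configuration w (length zs)) z₀ ≡
        feed (border ∷ []) (feed a (feed (centre w) (feed a (feed (border ∷ []) z₀))))
      fed = trans (feed-++ a _ _) (trans (feed-++ (centre w) _ _) (feed-++ a _ _))

  -- The ruler and the passes along it

  relₗ : Rel → Letter
  relₗ far  = farₗ
  relₗ prev = prevₗ
  relₗ cur  = curₗ
  relₗ next = nextₗ

  -- Writes far^S prev cur next far^S.  Row i of the table of `rel` is the window
  -- of length S which starts i cells left of cur.
  ruler : Program
  ruler =
    go stay stay stay right ⨟ forX (putZ (letter farₗ)) ⨟ putZ (letter prevₗ) ⨟ putZ (letter curₗ) ⨟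
      putZ (letter nextₗ) ⨟
    forX (putZ (letter farₗ)) ⨟ on (λ i x y z o → keep i ∷ keep x ∷ keep y ∷ keep rm ∷ keep o ∷ []) ⨟
    until not-prev tapeZ (go stay stay stay left)

  rulerTime : ℕ → ℕ
  rulerTime n = 1 + (forTime 1 n + (1 + (1 + (1 + (forTime 1 n + (1 + loopTime 1 (n + 3)))))))

  marks : ℕ → ℕ → List Letter
  marks b n = replicate b farₗ ++ prevₗ ∷ curₗ ∷ nextₗ ∷ replicate n farₗ

  module _ {i x y o : Track} where

    home-exec : ∀ n m ls js → let s = λ z → i ∷ x ∷ y ∷ z ∷ o ∷ [] in
      Exec (until not-prev tapeZ (go stay stay stay left))
        (s (mid (replicate n farₗ ++ nextₗ ∷ curₗ ∷ prevₗ ∷ ls) (replicate m farₗ) js)) (loopTime 1 (n + 3))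
        (s (mid ls (prevₗ ∷ curₗ ∷ nextₗ ∷ replicate (n + m) farₗ) js))
    home-exec (suc n) m ls js =
      loop (test m) (once (cong (λ z → i ∷ x ∷ y ∷ z ∷ o ∷ []) (retreat farₗ _ (replicate m farₗ) js)))
        (ending (cong (λ k → i ∷ x ∷ y ∷ mid ls (prevₗ ∷ curₗ ∷ nextₗ ∷ replicate k farₗ) js ∷ o ∷ [])
          (+-suc n m)) (home-exec n (suc m) ls js))
      where
      test : ∀ m → not-prev (here (mid (replicate (suc n) farₗ ++ nextₗ ∷ curₗ ∷ prevₗ ∷ ls)
        (replicate m farₗ) js)) ≡ true
      test zero    = refl
      test (suc m) = refl
    home-exec zero zero    ls js = loop refl (once refl) (loop refl (once refl) (loop refl (once refl) (stop refl)))
    home-exec zero (suc m) ls js = loop refl (once refl) (loop refl (once refl) (loop refl (once refl) (stop refl)))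

  replicate-ʳ++ : ∀ {A : Set} n (c : A) cs → replicate n c ʳ++ cs ≡ replicate n c ++ cs
  replicate-ʳ++ zero    c cs = refl
  replicate-ʳ++ (suc n) c cs = trans (replicate-ʳ++ n c (c ∷ cs)) (swap n)
    where
    swap : ∀ n → replicate n c ++ c ∷ cs ≡ c ∷ (replicate n c ++ cs)
    swap zero    = refl
    swap (suc n) = cong (c ∷_) (swap n)

  -- In row b, with a rows to follow, the head is on the cell left of the window.
  rulerTape : List Sym → ℕ → ℕ → ℕ → Track
  rulerTape js n a b = mid (replicate a farₗ) (marks b n) js

  ruler-exec : ∀ {i cs ts} → Twins i cs ts → ∃[ jx ] ∃[ jy ] ∃[ jz ] Exec ruler ts (rulerTime (length cs))
    (i ∷ rest cs jx ∷ rest cs jy ∷ rulerTape jz (length cs) (length cs) 0 ∷ tape [] blank [] ∷ [])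
  ruler-exec {i} {cs} (jx , jy , jz , refl) = jx , jy , js ,
    once (cong s (ready-opened jz)) ⨟ forX-put farₗ cs jx (opened [] jz) ⨟ once refl ⨟ once refl ⨟ once refl ⨟
      forX-put farₗ cs jx (feed m (feed f (opened [] jz))) ⨟
    once (cong s (trans (cong (act (rm , stay)) fed) (end-opened ls js₁))) ⨟
    subst₂ (λ k us → Exec (until not-prev tapeZ (go stay stay stay left)) (s (mid ls [] js))
      (loopTime 1 (S + 3)) (s (mid us (prevₗ ∷ curₗ ∷ nextₗ ∷ replicate k farₗ) js)))
      (+-identityʳ S) (++-identityʳ (replicate S farₗ)) (home-exec S 0 (replicate S farₗ ++ []) js)
    where
    s = λ z → i ∷ rest cs jx ∷ rest cs jy ∷ z ∷ tape [] blank [] ∷ []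
    S = length cs
    f = replicate S farₗ
    m = prevₗ ∷ curₗ ∷ nextₗ ∷ []
    vs = f ++ (m ++ f)
    ls = f ++ nextₗ ∷ curₗ ∷ prevₗ ∷ f ++ []
    js₁ = iterate (drop 1) jz (length vs)
    js = drop 1 js₁
    reversed : vs ʳ++ [] ≡ ls
    reversed = trans (++-ʳ++ f) (trans (++-ʳ++ m {f})
      (trans (replicate-ʳ++ S farₗ _) (cong (λ us → f ++ nextₗ ∷ curₗ ∷ prevₗ ∷ us) (replicate-ʳ++ S farₗ []))))
    fed : feed f (feed m (feed f (opened [] jz))) ≡ opened ls js₁
    fed = trans (sym (trans (feed-++ f (m ++ f) (opened [] jz)) (feed-++ m f (feed f (opened [] jz)))))
      (trans (feed-opened vs [] jz) (cong (λ us → opened us js₁) reversed))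

  -- The symbol `t` after the `n` symbols read is the cell on which the head stops. As it is already
  -- listed, a pass adds no cell, and walking back restores the very same tape.
  Covers : List Sym → ℕ → (ℕ → Sym) → Set
  Covers vs n f = ∃[ t ] ∃[ ts ] vs ≡ applyUpTo f n ++ t ∷ ts

  covers-pred : ∀ {vs f} n → Covers vs (suc n) f → Covers vs n f
  covers-pred {f = f} n (t , ts , refl) = f n , t ∷ ts , snoc f n
    where
    snoc : ∀ f n → applyUpTo f (suc n) ++ t ∷ ts ≡ applyUpTo f n ++ f n ∷ t ∷ ts
    snoc f zero    = refl
    snoc f (suc n) = cong (f 0 ∷_) (snoc (f ∘ suc) n)

  -- Since `rel (suc b) (suc j)` reduces to `rel b j`, the window of the next row is the present one
  -- preceded by the cell `u` and shortened at its end.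
  ruler-covers : ∀ b n js → ∃[ u ] ∃[ vs ] map (λ a → letter a) (marks b n) ++ rm ∷ js ≡ u ∷ vs × u ≡
    letter (relₗ (rel (suc b) 0))
    × Covers vs n (λ j → letter (relₗ (rel b j)))
  ruler-covers zero    n js = _ , _ , refl , refl ,
    covers-pred {f = f₀} n (covers-pred {f = f₀} (suc n)
    (rm , js , cong (λ us → letter curₗ ∷ letter nextₗ ∷ us) (fars n)))
    where
    f₀ : ℕ → Sym
    f₀ j = letter (relₗ (rel 0 j))
    fars : ∀ n → map (λ a → letter a) (replicate n farₗ) ++ rm ∷ js ≡ applyUpTo (λ _ → letter farₗ) n ++ rm ∷ js
    fars zero    = refl
    fars (suc n) = cong (letter farₗ ∷_) (fars n)
  ruler-covers (suc b) n js with ruler-covers b n js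
  ... | u , vs , eq , refl , covers = _ , _ , refl , refl ,
    covers-pred {f = λ j → letter (relₗ (rel (suc b) j))} n
      (proj₁ covers , proj₁ (proj₂ covers) , trans eq (cong (u ∷_) (proj₂ (proj₂ covers))))

  ruler-left : ∀ js n a b → move left (rulerTape js n (suc a) b) ≡ rulerTape js n a (suc b)
  ruler-left js n a b = retreat farₗ (replicate a farₗ) (marks b n) js

  ruler-right : ∀ js n a b → move right (rulerTape js n a (suc b)) ≡ rulerTape js n (suc a) b
  ruler-right js n a b = right-cursor _ _ _

  emits : (Sym → Sym → Bit) → List Letter → (ℕ → Sym) → List Bit
  emits g []       f = []
  emits g (c ∷ cs) f = g (letter c) (f 0) ∷ emits g cs (f ∘ suc)

  sweep : (Sym → Sym → Bit) → Program
  sweep g =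
    go stay right stay right ⨟
    until not-rm tapeX (on λ i x y z o → keep i ∷ (x , right) ∷ keep y ∷ (z , right) ∷ (bit (g x z) , right) ∷ []) ⨟
    until not-lm tapeX (go stay left stay left)

  sweepTime : ℕ → ℕ
  sweepTime n = 1 + (loopTime 1 n + loopTime 1 (suc n))

  Reads : Track → ℕ → (ℕ → Sym) → Set
  Reads z n f = ∃[ ls ] ∃[ u ] ∃[ vs ] z ≡ cursor ls (u ∷ vs) × Covers vs n f

  sweep-exec : ∀ {i y z} g cs jx f → Reads z (length cs) f → ∀ L →
    Exec (sweep g) (printed {i} {rest cs jx} {y} {z} L) (sweepTime (length cs))
      (printed {i} {rest cs jx} {y} {z} (emits g cs f ʳ++ L))
  sweep-exec {i} {y} g cs jx f (ls , u , vs , refl , t , ts , refl) L =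
    once (cong₂ (λ x z → i ∷ x ∷ y ∷ z ∷ O L ∷ []) (enter cs jx) (right-cursor ls u _)) ⨟
    ending (cong (λ (z , L) → s (z , L) (mid (reverse cs) [] jx)) (emitted cs (u ∷ ls) f L))
      (forward s (λ (z , L) c → move right z , g c (here z) ∷ L) (λ _ _ → refl) (λ _ _ → once refl) (z₁ , L)
        [] cs jx) ⨟
    ending (cong (λ z → i ∷ rest cs jx ∷ y ∷ z ∷ O (emits g cs f ʳ++ L) ∷ []) back)
      (rewind (λ z x → i ∷ x ∷ y ∷ z ∷ O (emits g cs f ʳ++ L) ∷ []) (move left) (λ _ _ → refl)
        (λ _ _ → once refl) (iterate (move right) z₁ n) cs jx)
    where
    n = length cs
    vs₁ = applyUpTo f n
    z₁ = cursor (u ∷ ls) (vs₁ ++ t ∷ ts)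
    O : List Bit → Track
    O L = tape (map bit L) blank []
    s : Track × List Bit → Track → Tapes
    s (z , L) x = i ∷ x ∷ y ∷ z ∷ O L ∷ []
    emitted : ∀ cs ls f L → let z = cursor ls (applyUpTo f (length cs) ++ t ∷ ts) in
      foldl (λ (z , L) c → move right z , g (letter c) (here z) ∷ L) (z , L) cs ≡
        (iterate (move right) z (length cs) , emits g cs f ʳ++ L)
    emitted []       ls f L = refl
    emitted (c ∷ cs) ls f L rewrite right-cursor ls (f 0) (applyUpTo (f ∘ suc) (length cs) ++ t ∷ ts) =
      emitted cs (f 0 ∷ ls) (f ∘ suc) (g (letter c) (f 0) ∷ L)
    back : iterate (move left) (iterate (move right) z₁ n) (suc n) ≡ tape ls u (vs₁ ++ t ∷ ts)
    back = begin
      iterate (move left) (iterate (move right) z₁ n) (suc n)   ≡⟨ iterate-suc (move left) _ n ⟩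
      move left (iterate (move left) (iterate (move right) z₁ n) n)
        ≡⟨ cong (λ k → move left (iterate (move left) (iterate (move right) z₁ k) k)) (sym (length-applyUpTo f n)) ⟩
      move left (iterate (move left) (iterate (move right) z₁ (length vs₁)) (length vs₁))
        ≡⟨ cong (move left) (there-and-back (u ∷ ls) vs₁ t ts) ⟩
      move left z₁                                              ≡⟨ left-z₁ vs₁ ⟩
      tape ls u (vs₁ ++ t ∷ ts)                                 ∎
      where
      open ≡-Reasoning
      left-z₁ : ∀ vs → move left (cursor (u ∷ ls) (vs ++ t ∷ ts)) ≡ tape ls u (vs ++ t ∷ ts)
      left-z₁ []      = refl
      left-z₁ (_ ∷ _) = refl

  mark : ℕ → ℕ → Sym
  mark r j = letter (relₗ (rel r j))

  reads-ruler : ∀ js n a b → Reads (rulerTape js n a b) n (mark b)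
  reads-ruler js n a b with ruler-covers b n js
  ... | u , vs , eq , _ , covers = _ , u , vs , cong (cursor _) eq , covers

  rows : Program → Program
  rows P =
    go stay stay right stay ⨟
    until not-rm tapeY (P ⨟ go stay stay right left) ⨟
    -- The way back over Y takes one move more than there were rows, so the ruler first makes one
    -- further move to the left, onto its `lm`.
    go stay stay stay left ⨟
    until not-lm tapeY (go stay stay left right)

  rowsTime : ℕ → ℕ → ℕ
  rowsTime t n = 1 + (loopTime (t + 1) n + (1 + loopTime 1 (suc n)))

  rowsOut : (ℕ → List Bit) → ℕ → ℕ → List Bit
  rowsOut e b zero    = []
  rowsOut e b (suc n) = e b ++ rowsOut e (suc b) n

  module _ {i x : Track} (P : Program) (t n : ℕ) (js : List Sym) (e : ℕ → List Bit)
    (body : ∀ y a b L → Exec P (printed {i} {x} {y} {rulerTape js n a b} L) t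
      (printed {i} {x} {y} {rulerTape js n a b} (e b ʳ++ L))) where

    rows-forward : ∀ zs ls b jy L → Exec (until not-rm tapeY (P ⨟ go stay stay right left))
      (printed {i} {x} {mid ls zs jy} {rulerTape js n (length zs) b} L) (loopTime (t + 1) (length zs))
      (printed {i} {x} {mid (zs ʳ++ ls) [] jy} {rulerTape js n 0 (length zs + b)} (rowsOut e b (length zs) ʳ++ L))
    rows-forward []       ls b jy L = stop refl
    rows-forward (z ∷ zs) ls b jy L = loop refl
      (body (mid ls (z ∷ zs) jy) (suc (length zs)) b L ⨟
       once (cong₂ (λ y z → printed {i} {x} {y} {z} (e b ʳ++ L)) (right-cursor _ (letter z) _)
         (ruler-left js n (length zs) b)))
      (ending (cong₂ (λ k L → printed {i} {x} {mid (zs ʳ++ (z ∷ ls)) [] jy} {rulerTape js n 0 k} L)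
        (+-suc (length zs) b) (sym (++-ʳ++ (e b))))
        (rows-forward zs (z ∷ ls) (suc b) jy (e b ʳ++ L)))

    rows-exec : ∀ zs jy L → Exec (rows P) (printed {i} {x} {rest zs jy} {rulerTape js n (length zs) 0} L)
      (rowsTime t (length zs))
      (printed {i} {x} {rest zs jy} {rulerTape js n (length zs) 0} (rowsOut e 0 (length zs) ʳ++ L))
    rows-exec zs jy L =
      once (cong (λ y → printed {i} {x} {y} {rulerTape js n (length zs) 0} L) (enter zs jy)) ⨟
      rows-forward zs [] 0 jy L ⨟
      once refl ⨟
      ending (cong (λ z → printed {i} {x} {rest zs jy} {z} L′) returned)
        (rewind (λ z y → printed {i} {x} {y} {z} L′) (move right) (λ _ _ → refl) (λ _ _ → once refl) _ zs jy)
      where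
      L′ = rowsOut e 0 (length zs) ʳ++ L
      rightmost : ∀ a b → iterate (move right) (rulerTape js n a b) b ≡ rulerTape js n (b + a) 0
      rightmost a zero    = refl
      rightmost a (suc b) rewrite ruler-right js n a b =
        trans (rightmost (suc a) b) (cong (λ k → rulerTape js n k 0) (+-suc b a))
      returned : iterate (move right) (move left (rulerTape js n 0 (length zs + 0))) (suc (length zs)) ≡
        rulerTape js n (length zs) 0
      returned rewrite +-identityʳ (length zs) | leave (marks (length zs) n) js | enter (marks (length zs) n) js =
        trans (rightmost 0 (length zs)) (cong (λ k → rulerTape js n k 0) (+-identityʳ (length zs)))

  module Sheet (kinds digits : ℕ) (g₁ g₂ g₃ : Fin kinds → Sym → Sym → Bit)
    (g₄ : Fin kinds → Fin kinds → Sym → Sym → Bit) where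

    one : Sym → Sym → Bit
    one _ _ = 1b

    -- A pass prints one bit per cell, so the unary number of vertices and the deadline are also
    -- made of passes. The vectors are printed in row 0 of the ruler, where `cur` marks exactly
    -- position zero; this singles out the initial vertex.
    print : Program
    print =
      each kinds (λ _ → sweep one) ⨟
      on (λ i x y z o → keep i ∷ keep x ∷ keep y ∷ keep z ∷ (bit 0b , right) ∷ []) ⨟
      each kinds (λ b → sweep (g₁ b)) ⨟
      each kinds (λ b → sweep (g₂ b)) ⨟
      each kinds (λ b → sweep (g₃ b)) ⨟
      each kinds (λ b → rows (each kinds λ b′ → sweep (g₄ b b′))) ⨟
      each digits (λ _ → sweep one)

    printTime : ℕ → ℕ
    printTime n = e + (1 + (e + (e + (e + (eachTime (rowsTime e n) kinds + eachTime (sweepTime n) digits)))))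
      where e = eachTime (sweepTime n) kinds

    row : List Letter → Fin kinds → ℕ → List Bit
    row cs b r = concat (tabulate λ b′ → emits (g₄ b b′) cs (mark r))

    output : List Letter → List Bit
    output cs =
      concat (tabulate {n = kinds} λ _ → emits one cs (mark 0)) ++ ((0b ∷ []) ++ (
      concat (tabulate λ b → emits (g₁ b) cs (mark 0)) ++ (
      concat (tabulate λ b → emits (g₂ b) cs (mark 0)) ++ (
      concat (tabulate λ b → emits (g₃ b) cs (mark 0)) ++ (
      concat (tabulate λ b → rowsOut (row cs b) 0 (length cs)) ++
      concat (tabulate {n = digits} λ _ → emits one cs (mark 0)))))))

    print-exec : ∀ {i} cs jx jy js → Exec print
      (printed {i} {rest cs jx} {rest cs jy} {rulerTape js (length cs) (length cs) 0} []) (printTime (length cs))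
      (printed {i} {rest cs jx} {rest cs jy} {rulerTape js (length cs) (length cs) 0} (reverse (output cs)))
    print-exec {i} cs jx jy js =
      ending (cong (printed {i} {rest cs jx} {rest cs jy} {rulerTape js n n 0}) assembled)
      (sweeps kinds (λ _ → one) _ n 0 [] ⨟
       once refl ⨟
       sweeps kinds g₁ _ n 0 _ ⨟
       sweeps kinds g₂ _ n 0 _ ⨟
       sweeps kinds g₃ _ n 0 _ ⨟
       each-exec kinds _ (λ b → rowsOut (row cs b) 0 n)
         (λ b → rows-exec _ (eachTime (sweepTime n) kinds) n js (row cs b)
         (λ y a r L → sweeps kinds (g₄ b) y a r L) cs jy) _ ⨟
       sweeps digits (λ _ → one) _ n 0 _)
      where
      n = length cs
      sweeps : ∀ k (g : Fin k → Sym → Sym → Bit) y a r L → Exec (each k λ b → sweep (g b))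
        (printed {i} {rest cs jx} {y} {rulerTape js n a r} L) (eachTime (sweepTime n) k)
        (printed {i} {rest cs jx} {y} {rulerTape js n a r} (concat (tabulate λ b → emits (g b) cs (mark r)) ʳ++ L))
      sweeps k g y a r = each-exec k _ (λ b → emits (g b) cs (mark r))
        (λ b → sweep-exec (g b) cs jx (mark r) (reads-ruler js n a r))
      e₁ = concat (tabulate {n = kinds} λ _ → emits one cs (mark 0))
      e₂ = concat (tabulate λ b → emits (g₁ b) cs (mark 0))
      e₃ = concat (tabulate λ b → emits (g₂ b) cs (mark 0))
      e₄ = concat (tabulate λ b → emits (g₃ b) cs (mark 0))
      e₅ = concat (tabulate λ b → rowsOut (row cs b) 0 n)
      e₆ = concat (tabulate {n = digits} λ _ → emits one cs (mark 0))
      assembled : e₆ ʳ++ (e₅ ʳ++ (e₄ ʳ++ (e₃ ʳ++ (e₂ ʳ++ (0b ∷ (e₁ ʳ++ [])))))) ≡ output cs ʳ++ []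
      assembled = sym (trans (++-ʳ++ e₁) (trans (++-ʳ++ e₂) (trans (++-ʳ++ e₃) (trans (++-ʳ++ e₄) (++-ʳ++ e₅)))))

    module _ (border pad : Letter) (lead : Maybe Bit → Letter) (follow : Bit → Letter) (k d : ℕ) where
      open Layout border pad lead follow

      printer : Program
      printer = setup k ⨟ grow d ⨟ layOut ⨟ ruler ⨟ print

      padding : ℕ → ℕ
      padding n = iterate (λ m → m * m) (k + n) d

      printerTime : ℕ → ℕ
      printerTime n = setupTime k n + (growTime d (k + n) + (layOutTime n (padding n) +
        (rulerTime (width n (padding n)) + printTime (width n (padding n)))))

      printer-exec : ∀ w → ∃[ i ] ∃[ x ] ∃[ y ] ∃[ z ] Exec printer (initial-tapes w) (printerTime (length w))
        (printed {i} {x} {y} {z} (reverse (output (configuration w (padding (length w))))))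
      printer-exec w with setup-exec k w
      ... | ji , zs₁ , ts₁ , len₁ , twins₁ , exec₁ with grow-exec d twins₁
      ... | zs₂ , ts₂ , len₂ , twins₂ ,
        exec₂ with layOut-exec (trans len₂ (cong (λ m → iterate (λ m → m * m) m d) len₁)) twins₂
      ... | i , ts₃ , twins₃ , exec₃ with ruler-exec {cs = configuration w (padding (length w))} twins₃
      ... | jx , jy , jz , exec₄ =
        _ , _ , _ , _ ,
        exec₁ ⨟ retime (cong (growTime d) len₁) exec₂ ⨟ exec₃ ⨟
        retime (cong rulerTime len) exec₄ ⨟
        retime (cong printTime len) (print-exec {i} (configuration w (padding (length w))) jx jy jz)
        where
        len : length (configuration w (padding (length w))) ≡ width (length w) (padding (length w))
        len = length-configuration w (padding (length w))

-- Polynomial time bounds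

-- With the base `suc n`, powers are monotone in the exponent even at zero, so bounds can be added
-- by adding their degrees.
Polynomial : (ℕ → ℕ) → Set
Polynomial f = ∃[ c ] ∃[ d ] ∀ n → f n ≤ c * suc n ^ d

κ : ∀ k → Polynomial (λ _ → k)
κ k = k , 0 , λ _ → ≤-reflexive (sym (*-identityʳ k))

ι : Polynomial (λ n → n)
ι = 1 , 1 , λ n → ≤-trans (n≤1+n n) (≤-reflexive (sym (trans (*-identityˡ _) (*-identityʳ _))))

infixl 6 _⊕_
infixl 7 _⊗_

_⊕_ : ∀ {f g} → Polynomial f → Polynomial g → Polynomial (λ n → f n + g n)
_⊕_ {f} {g} (c , d , f≤) (c′ , d′ , g≤) = c + c′ , d + d′ , λ n → begin
  f n + g n                                      ≤⟨ +-mono-≤ (f≤ n) (g≤ n) ⟩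
  c * suc n ^ d + c′ * suc n ^ d′                ≤⟨ +-mono-≤ (*-monoʳ-≤ c (^-monoʳ-≤ (suc n) (m≤m+n d d′)))
    (*-monoʳ-≤ c′ (^-monoʳ-≤ (suc n) (m≤n+m d′ d))) ⟩
  c * suc n ^ (d + d′) + c′ * suc n ^ (d + d′)   ≡⟨ sym (*-distribʳ-+ (suc n ^ (d + d′)) c c′) ⟩
  (c + c′) * suc n ^ (d + d′)                    ∎
  where open ≤-Reasoning

_⊗_ : ∀ {f g} → Polynomial f → Polynomial g → Polynomial (λ n → f n * g n)
_⊗_ {f} {g} (c , d , f≤) (c′ , d′ , g≤) = c * c′ , d + d′ , λ n → begin
  f n * g n                               ≤⟨ *-mono-≤ (f≤ n) (g≤ n) ⟩
  (c * suc n ^ d) * (c′ * suc n ^ d′)     ≡⟨ [m*n]*[o*p]≡[m*o]*[n*p] c (suc n ^ d) c′ (suc n ^ d′) ⟩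
  (c * c′) * (suc n ^ d * suc n ^ d′)     ≡⟨ cong ((c * c′) *_) (sym (^-distribˡ-+-* (suc n) d d′)) ⟩
  (c * c′) * suc n ^ (d + d′)             ∎
  where open ≤-Reasoning

bounded-by : ∀ {f g} → (∀ n → f n ≤ g n) → Polynomial g → Polynomial f
bounded-by f≤g (c , d , g≤) = c , d , λ n → ≤-trans (f≤g n) (g≤ n)

^-distribʳ-* : ∀ d m n → (m * n) ^ d ≡ m ^ d * n ^ d
^-distribʳ-* zero    m n = refl
^-distribʳ-* (suc d) m n = trans (cong (m * n *_) (^-distribʳ-* d m n)) ([m*n]*[o*p]≡[m*o]*[n*p] m n (m ^ d) (n ^ d))

-- For positive `n` the base `suc n` is at most `2 * n`, whence the factor `2 ^ d`; at zero the
-- additive constant takes over.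
polynomial⇒poly : ∀ {f} → Polynomial f → ∃[ c ] ∃[ d ] ∀ n → f n ≤ poly c d n
polynomial⇒poly {f} (c , d , f≤) = c * 2 ^ d , d , λ n → ≤-trans (f≤ n) (expand n)
  where
  open ≤-Reasoning
  expand : ∀ n → c * suc n ^ d ≤ poly (c * 2 ^ d) d n
  expand zero = begin
    c * 1 ^ d                            ≤⟨ *-monoʳ-≤ c (^-monoˡ-≤ d (s≤s z≤n)) ⟩
    c * 2 ^ d                            ≤⟨ m≤n+m (c * 2 ^ d) (c * 2 ^ d * 0 ^ d) ⟩
    c * 2 ^ d * 0 ^ d + c * 2 ^ d        ∎
  expand n@(suc m) = begin
    c * suc n ^ d                        ≤⟨ *-monoʳ-≤ c (^-monoˡ-≤ d 1+n≤2n) ⟩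
    c * (2 * n) ^ d                      ≡⟨ cong (c *_) (^-distribʳ-* d 2 n) ⟩
    c * (2 ^ d * n ^ d)                  ≡⟨ sym (*-assoc c (2 ^ d) (n ^ d)) ⟩
    c * 2 ^ d * n ^ d                    ≤⟨ m≤m+n _ (c * 2 ^ d) ⟩
    c * 2 ^ d * n ^ d + c * 2 ^ d        ∎
    where
    1+n≤2n : suc n ≤ 2 * n
    1+n≤2n = s≤s (subst (suc m ≤_) (sym (+-suc m (m + 0))) (s≤s (m≤m+n m (m + 0))))

loopTime-≡ : ∀ t n → loopTime t n ≡ n * suc t + 1
loopTime-≡ t zero    = refl
loopTime-≡ t (suc n) = cong suc (trans (cong (t +_) (loopTime-≡ t n)) (sym (+-assoc t (n * suc t) 1)))

eachTime-≡ : ∀ t n → eachTime t n ≡ n * t + 1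
eachTime-≡ t zero    = refl
eachTime-≡ t (suc n) = trans (cong (t +_) (eachTime-≡ t n)) (sym (+-assoc t (n * t) 1))

loop-polynomial : ∀ {t m} → Polynomial t → Polynomial m → Polynomial (λ n → loopTime (t n) (m n))
loop-polynomial {t} {m} pt pm = bounded-by (λ n → ≤-reflexive (loopTime-≡ (t n) (m n))) (pm ⊗ (κ 1 ⊕ pt) ⊕ κ 1)

each-polynomial : ∀ {t m} → Polynomial t → Polynomial m → Polynomial (λ n → eachTime (t n) (m n))
each-polynomial {t} {m} pt pm = bounded-by (λ n → ≤-reflexive (eachTime-≡ (t n) (m n))) (pm ⊗ pt ⊕ κ 1)

iterate-polynomial : ∀ d {m} → Polynomial m → Polynomial (λ n → iterate (λ m → m * m) (m n) d)
iterate-polynomial zero    p = p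
iterate-polynomial (suc d) p = iterate-polynomial d (p ⊗ p)

^≤iterate : ∀ d m → suc m ^ suc d ≤ iterate (λ m → m * m) (suc m) d
^≤iterate zero    m = ≤-reflexive (*-identityʳ (suc m))
-- The number `m + m * suc m` is the predecessor of the square of `suc m`, as the shape of the
-- statement demands.
^≤iterate (suc d) m = ≤-trans step (^≤iterate d (m + m * suc m))
  where
  open ≤-Reasoning
  step : suc m ^ suc (suc d) ≤ (suc m * suc m) ^ suc d
  step = begin
    suc m ^ suc (suc d)              ≤⟨ ^-monoʳ-≤ (suc m) (s≤s (s≤s (m≤n+m d d))) ⟩
    suc m ^ (suc (suc (d + d)))      ≡⟨ cong (λ k → suc m ^ suc k) (sym (+-suc d d)) ⟩
    suc m ^ (suc d + suc d)          ≡⟨ ^-distribˡ-+-* (suc m) (suc d) (suc d) ⟩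
    suc m ^ suc d * suc m ^ suc d    ≡⟨ sym (^-distribʳ-* (suc d) (suc m) (suc m)) ⟩
    (suc m * suc m) ^ suc d          ∎

-- The base `m` exceeds both `n` and `c + c` and is positive, so both summands are at most
-- `c * m ^ d`, and their sum is at most `m ^ suc d`. This is where the constant `suc (c + c)` comes
-- from.
poly≤padding : ∀ c d n → poly c d n ≤ iterate (λ m → m * m) (suc (c + c) + n) d
poly≤padding c d n = begin
  c * n ^ d + c                       ≤⟨ +-mono-≤ (*-monoʳ-≤ c (^-monoˡ-≤ d n≤m))
    (≤-trans (≤-reflexive (sym (*-identityʳ c))) (*-monoʳ-≤ c (m^n>0 m d))) ⟩
  c * m ^ d + c * m ^ d               ≡⟨ sym (*-distribʳ-+ (m ^ d) c c) ⟩
  (c + c) * m ^ d                     ≤⟨ *-monoˡ-≤ (m ^ d) c+c≤m ⟩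
  m * m ^ d                           ≤⟨ ^≤iterate d (c + c + n) ⟩
  iterate (λ m → m * m) m d           ∎
  where
  open ≤-Reasoning
  m = suc (c + c) + n
  n≤m : n ≤ m
  n≤m = m≤n+m n (suc (c + c))
  c+c≤m : c + c ≤ m
  c+c≤m = ≤-trans (n≤1+n (c + c)) (m≤m+n (suc (c + c)) n)

module _ (γ : ℕ) where
  open Output γ

  for-polynomial : ∀ {t m} → Polynomial t → Polynomial m → Polynomial (λ n → forTime (t n) (m n))
  for-polynomial pt pm = κ 1 ⊕ (loop-polynomial (pt ⊕ κ 1) pm ⊕ loop-polynomial (κ 1) (κ 1 ⊕ pm))

  finish-polynomial : ∀ {m} → Polynomial m → Polynomial (λ n → finishTime (m n))
  finish-polynomial pm = (κ 1 ⊕ back) ⊕ (κ 1 ⊕ (loop-polynomial (κ 1) pm ⊕ (κ 1 ⊕ (back ⊕ (back ⊕ back)))))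
    where back = loop-polynomial (κ 1) (κ 1 ⊕ pm)

  grow-polynomial : ∀ d {m} → Polynomial m → Polynomial (λ n → growTime d (m n))
  grow-polynomial zero    pm = κ 1
  grow-polynomial (suc d) pm =
    (κ 1 ⊕ (for-polynomial (for-polynomial (κ 1) pm) pm ⊕ finish-polynomial (pm ⊗ pm))) ⊕ grow-polynomial d (pm ⊗ pm)

  setup-polynomial : ∀ k → Polynomial (setupTime k)
  setup-polynomial k = κ 1 ⊕ (κ 1 ⊕
    (κ (eachTime 1 k) ⊕ (loop-polynomial (κ 1) ι ⊕ (κ 1 ⊕ (loop-polynomial (κ 1) (κ 1 ⊕ ι) ⊕ (back ⊕ back))))))
    where back = loop-polynomial (κ 1) (κ 1 ⊕ (κ k ⊕ ι))

  module _ (border pad : Letter) (lead : Maybe Bit → Letter) (follow : Bit → Letter) where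
    open Layout border pad lead follow

    pred-polynomial : Polynomial (λ n → n ∸ 1)
    pred-polynomial = bounded-by (λ n → m∸n≤m n 1) ι

    width-polynomial : ∀ {a} → Polynomial a → Polynomial (λ n → width n (a n))
    width-polynomial pa = κ 1 ⊕ (pa ⊕ ((κ 1 ⊕ pred-polynomial) ⊕ (pa ⊕ κ 1)))

    layOut-polynomial : ∀ {a} → Polynomial a → Polynomial (λ n → layOutTime n (a n))
    layOut-polynomial pa = κ 1 ⊕ (κ 1 ⊕ (for-polynomial (κ 1) pa ⊕ ((κ 1 ⊕ loop-polynomial (κ 1) pred-polynomial) ⊕
      (for-polynomial (κ 1) pa ⊕ (κ 1 ⊕ finish-polynomial (width-polynomial pa))))))

  ruler-polynomial : ∀ {m} → Polynomial m → Polynomial (λ n → rulerTime (m n))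
  ruler-polynomial pm = κ 1 ⊕ (for-polynomial (κ 1) pm ⊕
    (κ 3 ⊕ (for-polynomial (κ 1) pm ⊕ (κ 1 ⊕ loop-polynomial (κ 1) (pm ⊕ κ 3)))))

  module _ (kinds digits : ℕ) (g₁ g₂ g₃ : Fin kinds → Sym → Sym → Bit)
    (g₄ : Fin kinds → Fin kinds → Sym → Sym → Bit) where
    open Sheet kinds digits g₁ g₂ g₃ g₄

    sweep-polynomial : ∀ {m} → Polynomial m → Polynomial (λ n → sweepTime (m n))
    sweep-polynomial pm = κ 1 ⊕ (loop-polynomial (κ 1) pm ⊕ loop-polynomial (κ 1) (κ 1 ⊕ pm))

    rows-polynomial : ∀ {t m} → Polynomial t → Polynomial m → Polynomial (λ n → rowsTime (t n) (m n))
    rows-polynomial pt pm = κ 1 ⊕ (loop-polynomial (pt ⊕ κ 1) pm ⊕ (κ 1 ⊕ loop-polynomial (κ 1) (κ 1 ⊕ pm)))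

    print-polynomial : ∀ {m} → Polynomial m → Polynomial (λ n → printTime (m n))
    print-polynomial pm = e ⊕ (κ 1 ⊕
      (e ⊕ (e ⊕ (e ⊕ (each-polynomial (rows-polynomial e pm) (κ kinds) ⊕
      each-polynomial (sweep-polynomial pm) (κ digits))))))
      where e = each-polynomial (sweep-polynomial pm) (κ kinds)

    printer-polynomial : ∀ border pad lead follow k d → Polynomial (printerTime border pad lead follow k d)
    printer-polynomial border pad lead follow k d =
      setup-polynomial k ⊕ (grow-polynomial d (κ k ⊕ ι) ⊕
        (layOut-polynomial border pad lead follow pa ⊕ (ruler-polynomial pw ⊕ print-polynomial pw)))
      where
      pa = iterate-polynomial d (κ k ⊕ ι)
      pw = width-polynomial border pad lead follow pa

-- The reduction

tabulate-const : ∀ {a} {A : Set a} n (x : A) → tabulate {n = n} (λ _ → x) ≡ replicate n x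
tabulate-const zero    x = refl
tabulate-const (suc n) x = cong (x ∷_) (tabulate-const n x)

replicate-* : ∀ {a} {A : Set a} m n (x : A) → replicate (m * n) x ≡
  concat (tabulate {n = m} λ _ → tabulate {n = n} λ _ → x)
replicate-* m n x = trans (sym (tabulate-const (m * n) x)) (tabulate-* m n (λ _ → x))

concat-tabulate-remQuot : ∀ {a} {A : Set a} m {n} (f : Fin m × Fin n → List A) →
  concat (tabulate (f ∘ remQuot {m} n)) ≡ concat (tabulate λ i → concat (tabulate λ j → f (i , j)))
concat-tabulate-remQuot m f = trans (cong concat (tabulate-remQuot m f))
  (trans (sym (concat-concat (tabulate λ i → tabulate λ j → f (i , j))))
    (cong concat (map-tabulate (λ i → tabulate λ j → f (i , j)) concat)))

suc-fromDigits-ones : ∀ m → suc (fromDigits {2} (replicate m 1b)) ≡ 2 ^ m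
suc-fromDigits-ones zero    = refl
suc-fromDigits-ones (suc m) = trans (cong (_* 2) (suc-fromDigits-ones m)) (*-comm (2 ^ m) 2)

*2≡twice : ∀ n → n * 2 ≡ twice n
*2≡twice zero    = refl
*2≡twice (suc n) = cong (λ k → suc (suc k)) (*2≡twice n)

n≤2^n : ∀ n → n ≤ 2 ^ n
n≤2^n zero    = z≤n
n≤2^n (suc n) = +-mono-≤ (m^n>0 2 n) (≤-trans (n≤2^n n) (m≤m+n (2 ^ n) 0))

does-≡ : ∀ {a} {A : Set a} (a? : Dec A) {b} → (A → b ≡ true) → (¬ A → b ≡ false) → does a? ≡ b
does-≡ (yes a) t f = sym (t a)
does-≡ (no ¬a) t f = sym (f ¬a)

module Reduction (M : Machine 1) (c d : ℕ) where
  open Simulation M renaming (Letter to ΓM; Sym to SymM)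
  open Automaton automaton using
    (start; cell; triple; γ; kinds; kindOf; Kind; kind↔; ownerOf; kindEdge; kindTarget; kindStart; nth; module
    Board; evolve; _≟_)
  open Output γ

  encode : ΓM → Letter
  encode a = code (Inverse.to letter↔ a)

  relOf : Sym → Rel
  relOf (letter farₗ)  = far
  relOf (letter prevₗ) = prev
  relOf (letter curₗ)  = cur
  relOf (letter nextₗ) = next
  relOf _              = far

  decode : Sym → ΓM
  decode (letter (code a)) = Inverse.from letter↔ a
  decode _                 = wallₗ

  relOf-mark : ∀ r j → relOf (mark r j) ≡ rel r j
  relOf-mark r j with rel r j
  ... | far  = refl
  ... | prev = refl
  ... | cur  = refl
  ... | next = refl

  decode-encode : ∀ a → decode (letter (encode a)) ≡ a
  decode-encode a = Inverse.strictlyInverseʳ letter↔ a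

  ownerBit startBit targetBit : Fin kinds → Sym → Sym → Bit
  ownerBit  b x v = fromPlayer (ownerOf (kindOf b))
  startBit  b x v = fromBool (kindStart (kindOf b) (relOf v))
  targetBit b x v = fromBool (kindTarget (kindOf b) (decode x))

  edgeBit : Fin kinds → Fin kinds → Sym → Sym → Bit
  edgeBit b b′ x v = fromBool (kindEdge (kindOf b) (kindOf b′) (relOf v))

  -- With `S` cells, `γ * S` digits suffice to wait for all configurations. A further pass is added
  -- because the lowest digit is spent on the opening move and on the two moves per machine step.
  digits : ℕ
  digits = suc γ

  lead : Maybe Bit → Letter
  lead nothing  = encode (head (run (Machine.start M)) blank)
  lead (just b) = encode (head (run (Machine.start M)) (bit b))

  follow : Bit → Letter
  follow b = encode (plain (bit b))

  open Layout (encode wallₗ) (encode (plain blank)) lead follow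
  open Sheet kinds digits ownerBit startBit targetBit edgeBit

  P : Program
  P = printer (encode wallₗ) (encode (plain blank)) lead follow (suc (c + c)) d

  pad : Word → ℕ
  pad w = padding (encode wallₗ) (encode (plain blank)) lead follow (suc (c + c)) d (length w)

  start-tape : Word → Tape (Machine.extra M)
  start-tape w = fromList (map bit w)

  interior : Word → List ΓM
  interior w = replicate (pad w) (plain blank) ++
    (head (run (Machine.start M)) (here (start-tape w)) ∷ map plain (Tape.after (start-tape w))) ++
    (replicate (pad w) (plain blank) ++ (wallₗ ∷ []))

  layout-interior : ∀ w → layout (run (Machine.start M)) (start-tape w) (pad w) (pad w) ≡ wallₗ ∷ interior w
  layout-interior []       = trans (++-ʳ++ (replicate (pad []) (plain blank)))
    (cong (wallₗ ∷_) (replicate-ʳ++ (pad []) (plain blank) _))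
  layout-interior w@(_ ∷ _) = trans (++-ʳ++ (replicate (pad w) (plain blank)))
    (cong (wallₗ ∷_) (replicate-ʳ++ (pad w) (plain blank) _))

  configuration-interior : ∀ w → configuration w (pad w) ≡ map encode (wallₗ ∷ interior w)
  configuration-interior w = cong (encode wallₗ ∷_) (sym (trans (map-++ encode (replicate (pad w) (plain blank)) _)
    (cong₂ _++_ (map-replicate encode (pad w) _)
      (trans (map-++ encode (head (run (Machine.start M)) (here (start-tape w)) ∷
      map plain (Tape.after (start-tape w))) _)
      (cong₂ _++_ (centre-interior w)
        (trans (map-++ encode (replicate (pad w) (plain blank)) _)
        (cong (_++ (encode wallₗ ∷ [])) (map-replicate encode (pad w) _))))))))
    where
    centre-interior : ∀ w → map encode
      (head (run (Machine.start M)) (here (start-tape w)) ∷ map plain (Tape.after (start-tape w))) ≡ centre w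
    centre-interior []       = refl
    centre-interior (b ∷ bs) = cong (lead (just b) ∷_) (trans (sym (map-∘ (map bit bs))) (sym (map-∘ bs)))

  interior-last : ∀ w → nth (wallₗ ∷ interior w) (length (interior w)) ≡ wallₗ
  interior-last w = subst (λ xs → nth (wallₗ ∷ xs) (length xs) ≡ wallₗ) assoc (ends wallₗ (bs ++ (m ++ bs)))
    where
    bs = replicate (pad w) (plain blank)
    m = head (run (Machine.start M)) (here (start-tape w)) ∷ map plain (Tape.after (start-tape w))
    ends : ∀ y us → nth (y ∷ us ++ wallₗ ∷ []) (length (us ++ wallₗ ∷ [])) ≡ wallₗ
    ends y []       = refl
    ends y (u ∷ us) = ends u us
    assoc : (bs ++ (m ++ bs)) ++ wallₗ ∷ [] ≡ interior w
    assoc = trans (++-assoc bs (m ++ bs) _) (cong (bs ++_) (++-assoc m bs _))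

  emits-tabulate : ∀ ws g f → emits g (map encode ws) f ≡
    tabulate (λ j → g (letter (encode (lookup ws j))) (f (toℕ j)))
  emits-tabulate []       g f = refl
  emits-tabulate (a ∷ ws) g f = cong (g (letter (encode a)) (f 0) ∷_) (emits-tabulate ws g (f ∘ suc))

  rowsOut-tabulate : ∀ e b n → rowsOut e b n ≡ concat (tabulate {n = n} λ i → e (toℕ i + b))
  rowsOut-tabulate e b zero    = refl
  rowsOut-tabulate e b (suc n) = cong (e b ++_) (trans (rowsOut-tabulate e (suc b) n)
    (cong concat (tabulate-cong {n = n} λ i → cong e (+-suc (toℕ i) b))))

  module _ (xs : List ΓM) where
    open Board wallₗ xs

    -- The printing program cannot compare vertices, but the initial one is recognised by its kind
    -- and by the mark `cur` in row 0 of the ruler.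
    s₀-indicator : ∀ v → does (v Fin.≟ vertex start zero) ≡ kindStart (kind v) (rel 0 (toℕ (position v)))
    s₀-indicator v = does-≡ (v Fin.≟ vertex start zero)
      (λ { refl → cong₂ (λ k p → kindStart k (rel 0 (toℕ p))) (kind-vertex start zero) (position-vertex start zero) })
      (λ v≢s₀ → other (kind v) (position v) λ k≡ p≡ → v≢s₀ (trans (sym (vertex-split v)) (cong₂ vertex k≡ p≡)))
      where
      other : ∀ k p → (k ≡ start → p ≡ zero → T false) → kindStart k (rel 0 (toℕ p)) ≡ false
      other start          zero    ≢ = contradiction refl (λ eq → ≢ eq refl)
      other start          (suc p) ≢ = off (toℕ p)
        where
        off : ∀ j → kindStart start (rel 0 (suc j)) ≡ false
        off zero    = refl
        off (suc _) = refl
      other (cell _)       _       ≢ = refl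
      other (triple _ _ _) _       ≢ = refl

    ones : Word
    ones = replicate (digits * S) 1b

    -- A vertex is a kind followed by a position, so a table over vertices splits into one pass per
    -- kind. In the matrix this happens twice: kinds and then positions for the rows, and again
    -- kinds and then positions inside each row.
    output-encodes : output (map encode word) ≡ encodeGame game ++ ones
    output-encodes = sym (trans (encodeGame-++ game ones)
      (cong₂ _++_ (trans (replicate-* kinds S 1b) (same kinds λ _ → sym (emits-tabulate word one (mark 0))))
      (cong (0b ∷_) (cong₂ _++_ (trans
        (tabulate-remQuot kinds {S} λ (b , _) → fromPlayer (ownerOf (kindOf b)))
        (same kinds λ b → sym (emits-tabulate word (ownerBit b) (mark 0))))
      (cong₂ _++_ (trans (tabulate-cong (cong fromBool ∘ s₀-indicator))
          (trans (tabulate-remQuot kinds {S} λ (b , j) → fromBool (kindStart (kindOf b) (rel 0 (toℕ j))))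
            (same kinds λ b → sym (trans (emits-tabulate word (startBit b) (mark 0))
              (tabulate-cong λ j → cong (fromBool ∘ kindStart (kindOf b)) (relOf-mark 0 (toℕ j)))))))
      (cong₂ _++_ (trans (tabulate-remQuot kinds {S} λ (b , j) → fromBool (kindTarget (kindOf b) (lookup word j)))
            (same kinds λ b → sym (trans (emits-tabulate word (targetBit b) (mark 0))
              (tabulate-cong λ j → cong (fromBool ∘ kindTarget (kindOf b)) (decode-encode (lookup word j))))))
      (cong₂ _++_ matrix (trans (replicate-* digits S 1b)
        (same digits λ _ → sym (emits-tabulate word one (mark 0)))))))))))
      where
      same : ∀ n {f g : Fin n → List Bit} → (∀ b → f b ≡ g b) → concat (tabulate f) ≡ concat (tabulate g)
      same n eq = cong concat (tabulate-cong eq)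
      entries : Fin kinds × Fin S → List Bit
      entries (b , i) = tabulate λ v → fromBool (kindEdge (kindOf b) (kind v) (rel (toℕ i) (toℕ (position v))))
      matrix : concat (tabulate λ u → tabulate λ v → fromBool (Game.edge game u v))
             ≡ concat (tabulate λ b → rowsOut (row (map encode word) b) 0 (length (map encode word)))
      matrix = trans (concat-tabulate-remQuot kinds {S} entries) (same kinds λ b →
        sym (trans (cong (rowsOut (row (map encode word) b) 0) (length-map encode word))
          (trans (rowsOut-tabulate (row (map encode word) b) 0 S) (same S λ i →
            trans (cong (row (map encode word) b) (+-identityʳ (toℕ i)))
              (sym (trans (tabulate-remQuot kinds {S} λ (b′ , j) →
                fromBool (kindEdge (kindOf b) (kindOf b′) (rel (toℕ i) (toℕ j))))
                (same kinds λ b′ → sym (trans (emits-tabulate word (edgeBit b b′) (mark (toℕ i)))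
                  (tabulate-cong λ j → cong (fromBool ∘ kindEdge (kindOf b) (kindOf b′))
                    (relOf-mark (toℕ i) (toℕ j)))))))))))

  reduce : Word → Word
  reduce w = encodeGame (Board.game wallₗ (interior w)) ++ ones (interior w)

  output-reduce : ∀ w → output (configuration w (pad w)) ≡ reduce w
  output-reduce w = trans (cong output (configuration-interior w)) (output-encodes (interior w))

  runtime : ℕ → ℕ
  runtime = printerTime (encode wallₗ) (encode (plain blank)) lead follow (suc (c + c)) d

  contains-reverse : ∀ bs → Contains {2 + (4 + γ)} (tape (map bit (reverse bs)) blank []) bs
  -- The one blank is the cell under the head, just behind the output.
  contains-reverse bs = 0 , 1 ,
    cong (_++ blank ∷ []) (trans (cong reverse (reverse-map bit bs)) (reverse-involutive (map bit bs)))

  runtime-polynomial : Polynomial runtime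
  runtime-polynomial = printer-polynomial γ kinds digits ownerBit startBit targetBit edgeBit
    (encode wallₗ) (encode (plain blank)) lead follow (suc (c + c)) d

  runs : ∀ w → ∃[ ts ] Exec P (initial-tapes w) (runtime (length w)) ts ×
    Contains (Vec.lookup ts (fromℕ 4)) (reduce w)
  runs w =
    let i , x , y , z , exec = printer-exec (encode wallₗ) (encode (plain blank)) lead follow (suc (c + c)) d w
    in printed {i} {x} {y} {z} (reverse (output (configuration w (pad w)))) , exec ,
       subst (Contains (tape (map bit (reverse (output (configuration w (pad w))))) blank []))
         (output-reduce w) (contains-reverse _)

  reduce-polyTime : PolyTime reduce
  reduce-polyTime =
    let c , d , bound = polynomial⇒poly runtime-polynomial
    in 4 , machine P , c , d , exec⇒computes P {t = runtime} runs bound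

  module _ (bounded : SpaceBounded M (poly c d)) (w : Word) where
    open Run M

    within : ∀ t → space (after t steps-on w) ≤ pad w
    within t = ≤-trans (bounded w t) (poly≤padding c d (length w))

    open Board wallₗ (interior w)

    -- The digits of the deadline without the lowest one, in the form to which `digits * S` reduces;
    -- this exposes the leading `1b` in `deadline` by computation.
    spare : ℕ
    spare = length (interior w) + γ * S

    H : ℕ
    H = fromDigits {2} (replicate spare 1b)

    deadline : fromDigits {2} (ones (interior w)) ≡ suc (twice H)
    deadline = cong suc (*2≡twice H)

    -- The crude bound of `γ` by `2 ^ γ` replaces a logarithm, so the number of digits is linear in
    -- `S` with a factor fixed by the machine.
    enough : γ ^ S ≤ suc H
    enough = begin
      γ ^ S           ≤⟨ ^-monoˡ-≤ S (n≤2^n γ) ⟩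
      (2 ^ γ) ^ S     ≡⟨ ^-*-assoc 2 γ S ⟩
      2 ^ (γ * S)     ≤⟨ ^-monoʳ-≤ 2 (m≤n+m (γ * S) (length (interior w))) ⟩
      2 ^ spare       ≡⟨ sym (suc-fromDigits-ones spare) ⟩
      suc H           ∎
      where open ≤-Reasoning

    halts-true⇔PR : (∃[ t ] control (after t steps-on w) ≡ halt true) ⇔ PunctualReachability (reduce w)
    halts-true⇔PR = ⇔-trans accepts
      (⇔-trans (⇔-sym (Wins⇔accept refl (interior-last w) H))
      (⇔-trans at-deadline (⇔-sym (PR⇔Win game (ones (interior w))))))
      where
      accepts : (∃[ t ] control (after t steps-on w) ≡ halt true) ⇔ (∃[ p ] T (acceptₗ (lookup (evolve word H) p)))
      accepts = subst (λ ws → γ ^ length ws ≤ suc H →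
        (∃[ t ] control (after t steps-on w) ≡ halt true) ⇔ (∃[ p ] T (acceptₗ (lookup (evolve ws H) p))))
        (layout-interior w) (accepts-in-time w (pad w) within H) enough
      at-deadline : Attractor.Win game (suc (twice H)) (Game.s₀ game) ⇔ Attractor.Win game
        (fromDigits {2} (ones (interior w))) (Game.s₀ game)
      at-deadline = subst (λ τ → Attractor.Win game τ (Game.s₀ game) ⇔ Attractor.Win game
        (fromDigits {2} (ones (interior w))) (Game.s₀ game)) deadline ⇔-refl

    -- Were the machine to halt with `false` at `t` and with `true` at `t′`, both verdicts would
    -- persist to the time `t + t′`.
    decides⇔halts-true : ∀ {L} → Decides M L → L w ⇔ (∃[ t ] control (after t steps-on w) ≡ halt true)
    decides⇔halts-true {L} decides with decides w
    ... | t , true  , halts , ofʸ w∈L = mk⇔ (λ _ → t , halts) (λ _ → w∈L)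
    ... | t , false , halts , ofⁿ w∉L = mk⇔ (λ w∈L → contradiction w∈L w∉L) λ (t′ , halts′) →
      contradiction (trans (sym (halt-stable w (pad w) within {t′} t halts′))
        (trans (cong (λ n → control (after n steps-on w)) (+-comm t t′))
          (halt-stable w (pad w) within {t} t′ halts))) λ ()

lemma2 : PSPACE-Hard PunctualReachability
lemma2 L (M , decides , c , d , bounded) =
  reduce , reduce-polyTime , λ w → ⇔-trans (decides⇔halts-true bounded w decides) (halts-true⇔PR bounded w)
  where open Reduction M c d
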